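{- There is an absolute constant $c>0$ such that if $\mathrm{bitpdim}(f_n)\le d(n)$ for a family $\{f_n\}_{n\ge 0}$ of Boolean functions on $2n$ bits, $f_n:\{0,1\}^n\times\{0,1\}^n\to\{0,1\}$, then there is a deterministic branching program of size $(d(n))^c$ computing $f_n$.
   Context: Deterministic branching program: a directed acyclic graph with distinct start, accept and reject nodes; accept and reject (the sinks) have out-degree $0$; every other vertex is labelled by an input variable and has two outgoing edges, labelled $0$ and $1$. On an input, an edge labelled $b$ leaving a vertex labelled $z$ is closed if $z=b$. The program accepts iff there is a path of closed edges from start to accept; it computes $f$ if it accepts exactly the inputs with $f=1$. Its size is the number of vertices (including accept and reject). Bitwise decomposable projective dimension: for $f:\{0,1\}^n\times\{0,1\}^n\to\{0,1\}$, $\mathrm{bitpdim}(f)\le d$ if there are subspaces of $\mathbb{F}_2^d$, $\mathcal{C}=\{U_i^a\}_{i\in[n],a\in\{0,1\}}$ and $\mathcal{D}=\{V_j^b\}_{j\in[n],b\in\{0,1\}}$, such that: (1) with $\phi(x)=\mathrm{span}_{1\le i\le n}U_i^{x_i}$ for $x\in\{0,1\}^n$ on the left side and $\phi(y)=\mathrm{span}_{1\le j\le n}V_j^{y_j}$ for $y\in\{0,1\}^n$ on the right side, for all $(x,y)$: $f(x,y)=1$ iff $\phi(x)\cap\phi(y)\neq\{0\}$; (2) each $W\in\mathcal{C}\cup\mathcal{D}$ equals $\mathrm{span}(S')$ for some $S'\subseteq S=\{e_i-e_j: i,j\in[d], i\ne j\}$, where $e_i$ are the standard basis vectors; (3) for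 all disjoint $S_1,S_2\subseteq[n]\times\{0,1\}$, $\mathrm{span}_{(i,a)\in S_1}U_i^a\cap\mathrm{span}_{(j,b)\in S_2}U_j^b=\{0\}$, and likewise for the subspaces $V_j^b$ in $\mathcal{D}$. $\mathrm{bitpdim}(f)$ is the least such $d$.
   Formalization: The claim is made for n ≥ 1 and d(n) ≥ 2 only: for n = 0 no variable can label the start node, and for d(n) ≤ 1 the zero function qualifies though every program has at least 3 vertices; subsets S' of S are taken with decidable membership (automatic classically). -}

module Defs where

open import Algebra.Bundles using (CommutativeRing)
open import Data.Bool.Base using (Bool; true)
open import Data.Fin.Base using (Fin)
open import Data.Nat.Base using (ℕ; _+_)
import Data.Parity.Properties as Parity
open import Data.Product.Base using (_×_; _,_; ∃; ∃₂; ∃-syntax)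
open import Data.Vec.Base using (Vec; lookup; map; replicate; zipWith; _++_; _[_]≔_)
open import Function.Bundles using (_⇔_)
open import Level using (0ℓ; suc)
open import Relation.Binary.Construct.Closure.ReflexiveTransitive using (Star)
open import Relation.Binary.Construct.Closure.Transitive using (TransClosure)
open import Relation.Binary.Core using (Rel)
open import Relation.Binary.PropositionalEquality.Core using (_≡_; _≢_)
open import Relation.Nullary.Negation.Core using (¬_)
open import Relation.Unary using (Pred; Decidable; ｛_｝; _∈_; _⊆_; _≐_; _∩_; _⊥_)

BitString : ℕ → Set
BitString n = Vec Bool n

BoolFun₂ : ℕ → Set
BoolFun₂ n = BitString n → BitString n → Bool

------------------------------------------------------------------------
-- Deterministic branching programs

data Vertex (k : ℕ) : Set where
  accept reject : Vertex k
  inner         : Fin k → Vertex k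

data Edge {k : ℕ} (next : Fin k → Bool → Vertex k) : Rel (Vertex k) 0ℓ where
  edge : ∀ i b → Edge next (inner i) (next i b)

-- A program on the input variables z₀, …, z₍ₘ₋₁₎.  The start vertex is an
-- inner vertex, so start, accept and reject are pairwise distinct; only inner
-- vertices carry a label and outgoing edges (next i b is the head of the edge
-- labelled b leaving inner i).
record BranchingProgram (m : ℕ) : Set where
  field
    innerCount : ℕ
    start      : Fin innerCount
    label      : Fin innerCount → Fin m
    next       : Fin innerCount → Bool → Vertex innerCount
    acyclic    : ∀ v → ¬ TransClosure (Edge next) v v

  size : ℕ
  size = 2 + innerCount

  data ClosedEdge (z : BitString m) : Rel (Vertex innerCount) 0ℓ where
    closed : ∀ i b → lookup z (label i) ≡ b →
             ClosedEdge z (inner i) (next i b)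

  Accepts : BitString m → Set
  Accepts z = Star (ClosedEdge z) (inner start) accept

Computes : ∀ {n} → BranchingProgram (n + n) → BoolFun₂ n → Set
Computes P f = ∀ x y → BranchingProgram.Accepts P (x ++ y) ⇔ (f x y ≡ true)

------------------------------------------------------------------------
-- Linear algebra over the two-element field

module F₂ = CommutativeRing Parity.+-*-commutativeRing

F₂^_ : ℕ → Set
F₂^ d = Vec F₂.Carrier d

module _ {d : ℕ} where

  infixl 6 _+ᵛ_ _-ᵛ_
  infixr 7 _*ᵛ_

  0ᵛ : F₂^ d
  0ᵛ = replicate d F₂.0#

  _+ᵛ_ _-ᵛ_ : F₂^ d → F₂^ d → F₂^ d
  _+ᵛ_ = zipWith F₂._+_
  _-ᵛ_ = zipWith F₂._-_

  _*ᵛ_ : F₂.Carrier → F₂^ d → F₂^ d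
  a *ᵛ v = map (a F₂.*_) v

  e : Fin d → F₂^ d
  e i = 0ᵛ [ i ]≔ F₂.1#

  data Span (P : Pred (F₂^ d) 0ℓ) : Pred (F₂^ d) 0ℓ where
    gen  : ∀ {v} → v ∈ P → v ∈ Span P
    zero : 0ᵛ ∈ Span P
    add  : ∀ {v w} → v ∈ Span P → w ∈ Span P → v +ᵛ w ∈ Span P
    mul  : ∀ a {v} → v ∈ Span P → a *ᵛ v ∈ Span P

  Differences : Pred (F₂^ d) 0ℓ
  Differences v = ∃₂ λ i j → i ≢ j × v ≡ e i -ᵛ e j

record Subspace (d : ℕ) : Set₁ where
  field
    ⟦_⟧      : Pred (F₂^ d) 0ℓ
    0-closed : 0ᵛ ∈ ⟦_⟧
    +-closed : ∀ {v w} → v ∈ ⟦_⟧ → w ∈ ⟦_⟧ → v +ᵛ w ∈ ⟦_⟧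
    *-closed : ∀ a {v} → v ∈ ⟦_⟧ → a *ᵛ v ∈ ⟦_⟧

open Subspace public using (⟦_⟧)

------------------------------------------------------------------------
-- Bitwise decomposable projective dimension

-- One side of a decomposition: a subspace for each index and bit value.
Family : ℕ → ℕ → Set₁
Family n d = Fin n → Bool → Subspace d

module _ {n d : ℕ} where

  φ : Family n d → BitString n → Pred (F₂^ d) 0ℓ
  φ U x = Span λ v → ∃[ i ] v ∈ ⟦ U i (lookup x i) ⟧

  spanOver : Family n d → Pred (Fin n × Bool) 0ℓ → Pred (F₂^ d) 0ℓ
  spanOver U T = Span λ v → ∃₂ λ i a → (i , a) ∈ T × v ∈ ⟦ U i a ⟧

  -- Subsets of the finite set Differences are taken to be decidable, as is
  -- automatic classically.
  SpannedByDifferences : Family n d → Set₁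
  SpannedByDifferences U = ∀ i a →
    ∃ λ (S′ : Pred (F₂^ d) 0ℓ) →
      Decidable S′ × S′ ⊆ Differences × ⟦ U i a ⟧ ≐ Span S′

  Independent : Family n d → Set₁
  Independent U = ∀ (S₁ S₂ : Pred (Fin n × Bool) 0ℓ) → S₁ ⊥ S₂ →
    spanOver U S₁ ∩ spanOver U S₂ ≐ ｛ 0ᵛ ｝

record BitwiseDecomposition {n : ℕ} (f : BoolFun₂ n) (d : ℕ) : Set₁ where
  field
    U V            : Family n d
    represents     : ∀ x y → (f x y ≡ true) ⇔ (¬ (φ U x ∩ φ V y ≐ ｛ 0ᵛ ｝))
    U-differences  : SpannedByDifferences U
    V-differences  : SpannedByDifferences V
    U-independent  : Independent U
    V-independent  : Independent V

-- The relation "bitpdim f is at most d".  The dimensions admitting a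
-- decomposition are upward closed (append zero coordinates), so this agrees
-- with comparing the least such dimension to d.
bitpdim_≤_ : ∀ {n} → BoolFun₂ n → ℕ → Set₁
bitpdim f ≤ d = BitwiseDecomposition f d

{-# OPTIONS --safe #-}

-- Independence makes the whole family {U_i^a} a direct sum, so a basis of
-- edge vectors e i - e j chosen greedily splits into bases of the single
-- subspaces.  Hence each chosen edge is switched on by one literal, and φ(x) is
-- the edge space of a forest on [d] depending on x; the same holds for φ(y).
-- The two spaces meet outside 0 iff the union of the two forests, as a
-- multigraph, contains a cycle.
--
-- Cycles are detected by the Euler tour method.  On arriving at a vertex
-- through an edge slot, move on to the next slot in cyclic order and cross its
-- edge if it is present.  This is a permutation of the darts (vertex , slot),
-- so every tour returns to its first vertex.  The graph is a forest iff every
-- tour returns for the first time through the dart it started with.  A program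
-- only has to store the initial dart, the current dart and a clock.

module Submission where

open import Defs
import Algebra.Properties.CommutativeMonoid.Sum as Sum
open import Algebra.Bundles using (CommutativeMonoid)
open import Data.Bool.Base using (Bool; true; false)
import Data.Bool.Properties as Bool
open import Data.Empty using (⊥)
open import Data.Fin.Base using (Fin; zero; suc; toℕ; fromℕ; inject₁; combine; remQuot; _↑ˡ_; _↑ʳ_; splitAt)
open import Data.Fin.Induction using (<-weakInduction)
open import Data.Fin.Permutation.Components using (transpose)
open import Data.Fin.Properties as Fin
  using (remQuot-combine; combine-injective; toℕ-fromℕ; toℕ-inject₁; toℕ-injective; toℕ<n; pigeonhole;
         splitAt-↑ˡ; splitAt-↑ʳ; splitAt⁻¹-↑ˡ; splitAt⁻¹-↑ʳ; any?)
open import Data.Fin.Relation.Unary.Top using (view; ‵fromℕ; ‵inject₁; view-fromℕ; view-inject₁)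
open import Data.Nat.Base using (ℕ; zero; suc; NonZero; _+_; _*_; _∸_; _^_; _≤_; _<_; z≤n; s≤s)
open import Data.Nat.Induction using (<-rec)
open import Data.Nat.Properties
  using (≤-refl; ≤-trans; ≤-reflexive; ≤-antisym; ≤-pred; <⇒≤; <-trans; <-irrefl;
         ≤-<-trans; ≤-<-connex; ≮⇒≥; ≤∧≢⇒<; m≤n⇒m<n∨m≡n; n<1+n; _<?_; m≤m+n; m≤n+m;
         m+[n∸m]≡n; +-suc; +-comm; +-identityʳ; *-identityʳ; +-cancelˡ-<; +-cancelˡ-≤;
         +-monoˡ-≤; +-mono-≤; *-monoˡ-≤; *-monoʳ-≤; *-mono-≤; ^-monoʳ-≤; ^-distribˡ-+-*;
         module ≤-Reasoning)
open import Data.Parity.Base using (Parity; 0ℙ; 1ℙ)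
import Data.Parity.Properties as ℙ
open import Data.Product.Base using (_×_; _,_; proj₁; proj₂; Σ-syntax; ∃; ∃-syntax; ∃₂; uncurry)
open import Data.Product.Properties using (≡-dec)
open import Data.Sum.Base using (_⊎_; inj₁; inj₂; [_,_]′; map₁)
open import Data.Unit.Base using (⊤; tt)
open import Data.Vec.Base using (lookup; []; _∷_) renaming (_++_ to _++ᵛ_)
open import Data.Vec.Functional as Vector using (removeAt; _++_)
import Data.Vec.Functional.Properties as Vector
import Data.Vec.Properties as Vec
open import Function.Base using (_∘_; id)
open import Function.Bundles using (_⇔_; mk⇔; Equivalence)
open import Function.Construct.Composition using (_⇔-∘_)
open import Function.Construct.Symmetry using (⇔-sym)
open import Level using (0ℓ)
open import Relation.Binary.Construct.Closure.ReflexiveTransitive using (Star; ε; _◅_)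
open import Relation.Binary.Construct.Closure.Transitive using (TransClosure; [_]; _∷_)
open import Relation.Binary.PropositionalEquality
open import Relation.Nullary.Decidable
  using (Dec; yes; no; does; map′; _⊎-dec_; _×-dec_; ¬?; dec-true; decidable-stable)
open import Relation.Nullary.Negation.Core using (¬_; contradiction)
open import Relation.Unary using (Pred; Decidable; _∈_; _⊆_; _∩_; ∁; ｛_｝; _≐_)

open Sum ℙ.+-0-commutativeMonoid using (sum; sum-remove; sum-cong-≗; sum-replicate-zero)
open F₂ using () renaming (_+_ to infixl 6 _⊕_; _*_ to infixl 7 _⊗_)

-- Bounded runs of a finite-state machine as branching programs

run : ∀ {St : Set} → (St → St ⊎ Bool) → ℕ → St → Bool
run step zero    s = false
run step (suc t) s = [ run step t , id ]′ (step s)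

run-map : ∀ {St St′ : Set} (enc : St → St′) (dec : St′ → St) → dec ∘ enc ≗ id →
          (step : St → St ⊎ Bool) →
          ∀ t s → run (map₁ enc ∘ step ∘ dec) t (enc s) ≡ run step t s
run-map enc dec dec-enc step zero    s = refl
run-map enc dec dec-enc step (suc t) s rewrite dec-enc s with step s
... | inj₁ s′ = run-map enc dec dec-enc step t s′
... | inj₂ b  = refl

module Unroll {m S : ℕ} (lab : Fin S → Fin m) (δ : Fin S → Bool → Fin S ⊎ Bool) where

  -- Layers are numbered by the remaining time, and an edge between inner vertices leads one layer
  -- down; hence the unrolled graph is acyclic. A machine still running when the clock stops is
  -- rejected, in agreement with `run step zero`.
  goto : ∀ {T} → Fin T → Fin S ⊎ Bool → Vertex (T * S)
  goto i       (inj₂ true)  = accept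
  goto i       (inj₂ false) = reject
  goto zero    (inj₁ s)     = reject
  goto (suc i) (inj₁ s)     = inner (combine (inject₁ i) s)

  module _ (T : ℕ) where

    time : Fin (T * S) → Fin T
    time j = proj₁ (remQuot S j)

    state : Fin (T * S) → Fin S
    state j = proj₂ (remQuot {T} S j)

    next : Fin (T * S) → Bool → Vertex (T * S)
    next j b = goto (time j) (δ (state j) b)

    rank : Vertex (T * S) → ℕ
    rank accept    = 0
    rank reject    = 0
    rank (inner j) = suc (toℕ (time j))

    rank-goto : ∀ (i : Fin T) o → rank (goto i o) ≤ toℕ i
    rank-goto i       (inj₂ true)  = z≤n
    rank-goto i       (inj₂ false) = z≤n
    rank-goto zero    (inj₁ s)     = z≤n
    rank-goto (suc i) (inj₁ s)     = ≤-reflexive (cong suc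
      (trans (cong (toℕ ∘ proj₁) (remQuot-combine (inject₁ i) s)) (toℕ-inject₁ i)))

    rank-edge : ∀ {u v} → Edge next u v → rank v < rank u
    rank-edge (edge j b) = s≤s (rank-goto (time j) (δ (state j) b))

    rank-path : ∀ {u v} → TransClosure (Edge next) u v → rank v < rank u
    rank-path [ e ]   = rank-edge e
    rank-path (e ∷ p) = <-trans (rank-path p) (rank-edge e)

  module _ (T : ℕ) (s₀ : Fin S) where

    program : BranchingProgram m
    program = record
      { innerCount = suc T * S
      ; start      = combine (fromℕ T) s₀
      ; label      = lab ∘ state (suc T)
      ; next       = next (suc T)
      ; acyclic    = λ v p → <-irrefl refl (rank-path (suc T) p)
      }

    open BranchingProgram program using (ClosedEdge; closed; Accepts)

    module _ (z : BitString m) where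

      step : Fin S → Fin S ⊎ Bool
      step s = δ s (lookup z (lab s))

      -- The answer of the machine resumed at this vertex. It is constant along closed edges, so a
      -- path to `accept` forces the value `true` at its first vertex.
      value : Vertex (suc T * S) → Bool
      value accept    = true
      value reject    = false
      value (inner j) = run step (suc (toℕ (time (suc T) j))) (state (suc T) j)

      value-inner : ∀ i s → value (inner (combine i s)) ≡ run step (suc (toℕ i)) s
      value-inner i s =
        cong (λ p → run step (suc (toℕ (proj₁ p))) (proj₂ p)) (remQuot-combine {suc T} i s)

      value-goto : ∀ (i : Fin (suc T)) o → value (goto i o) ≡ [ run step (toℕ i) , id ]′ o
      value-goto i       (inj₂ true)  = refl
      value-goto i       (inj₂ false) = refl
      value-goto zero    (inj₁ s)     = refl
      value-goto (suc i) (inj₁ s)     =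
        trans (value-inner (inject₁ i) s) (cong (λ t → run step (suc t) s) (toℕ-inject₁ i))

      value-edge : ∀ {u v} → ClosedEdge z u v → value u ≡ value v
      value-edge (closed j b refl) = sym (value-goto (time (suc T) j) (step (state (suc T) j)))

      value-path : ∀ {u v} → Star (ClosedEdge z) u v → value u ≡ value v
      value-path ε       = refl
      value-path (e ◅ p) = trans (value-edge e) (value-path p)

      -- Following the closed edge keeps the value and lowers the rank, so the walk ends in a sink,
      -- and the value `true` excludes `reject`.
      accepting-path : ∀ r v → rank (suc T) v ≤ r → value v ≡ true →
                       Star (ClosedEdge z) v accept
      accepting-path r       accept    v≤r       eq = ε
      accepting-path (suc r) (inner j) (s≤s v≤r) eq =
        step₁ ◅ accepting-path r _ (≤-trans (rank-goto (suc T) (time (suc T) j) _) v≤r)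
                             (trans (sym (value-edge step₁)) eq)
        where step₁ = closed j _ refl

      value-start : value (inner (combine (fromℕ T) s₀)) ≡ run step (suc T) s₀
      value-start =
        trans (value-inner (fromℕ T) s₀) (cong (λ t → run step (suc t) s₀) (toℕ-fromℕ T))

      accepts⇔run : Accepts z ⇔ (run step (suc T) s₀ ≡ true)
      accepts⇔run = mk⇔
        (λ p → trans (sym value-start) (value-path p))
        (λ eq → accepting-path _ _ ≤-refl (trans value-start eq))

-- Parity sums, least witnesses and cyclic rotation

sum-single : ∀ {k} (f : Fin k → Parity) i → (∀ j → j ≢ i → f j ≡ 0ℙ) → sum f ≡ f i
sum-single {suc k} f i f≡0 = begin
  sum f                      ≡⟨ sum-remove {i = i} f ⟩
  f i ⊕ sum (removeAt f i)   ≡⟨ cong (f i ⊕_) (sum-cong-≗ λ j → f≡0 _ (Fin.punchInᵢ≢i i j)) ⟩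
  f i ⊕ (sum {k} λ _ → 0ℙ)   ≡⟨ cong (f i ⊕_) (sum-replicate-zero k) ⟩
  f i ⊕ 0ℙ                   ≡⟨ ℙ.+-identityʳ (f i) ⟩
  f i                        ∎
  where open ≡-Reasoning

least : ∀ {P : ℕ → Set} → Decidable P → ∀ n → P n →
        ∃[ m ] m ≤ n × P m × (∀ s → s < m → ¬ P s)
least P? zero p = zero , z≤n , p , λ _ ()
least P? (suc n) p with P? zero
... | yes p₀ = zero , z≤n , p₀ , λ _ ()
... | no ¬p₀ with m , m≤n , pm , min ← least (P? ∘ suc) n p =
  suc m , s≤s m≤n , pm , λ { zero _ → ¬p₀ ; (suc s) (s≤s s<m) → min s s<m }

-- The cyclic successor modulo `suc k`.
turn : ∀ {k} → Fin (suc k) → Fin (suc k)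
turn i with view i
... | ‵fromℕ     = zero
... | ‵inject₁ j = suc j

turn-fromℕ : ∀ k → turn (fromℕ k) ≡ zero
turn-fromℕ k rewrite view-fromℕ k = refl

turn-inject₁ : ∀ {k} (j : Fin k) → turn (inject₁ j) ≡ suc j
turn-inject₁ j rewrite view-inject₁ j = refl

turn-injective : ∀ {k} {i j : Fin (suc k)} → turn i ≡ turn j → i ≡ j
turn-injective {i = i} {j} eq with view i | view j
... | ‵fromℕ     | ‵fromℕ     = refl
... | ‵inject₁ _ | ‵inject₁ _ = cong inject₁ (Fin.suc-injective eq)

-- One trip around the cycle that starts just after `a` and ends at `a`: `above` climbs to the top
-- index, `first` wraps to `zero`, and `below` climbs to `a`.
turn-induction : ∀ {k} (P : Fin (suc k) → Set) a → P (turn a) →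
                 (∀ b → b ≢ a → P b → P (turn b)) → ∀ b → P b
turn-induction {k} P a start step b = [ below b , above b ]′ (≤-<-connex (toℕ b) (toℕ a))
  where
  advance : ∀ b → (b ≢ a → P b) → P (turn b)
  advance b p with b Fin.≟ a
  ... | yes refl = start
  ... | no  b≢a  = step b b≢a (p b≢a)

  above : ∀ b → toℕ a < toℕ b → P b
  above = <-weakInduction (λ b → toℕ a < toℕ b → P b) (λ ()) λ { j ih (s≤s a≤j) →
    subst P (turn-inject₁ j) (advance (inject₁ j) λ j≢a →
      ih (≤∧≢⇒< (subst (toℕ a ≤_) (sym (toℕ-inject₁ j)) a≤j) (j≢a ∘ toℕ-injective ∘ sym))) }

  first : P zero
  first = subst P (turn-fromℕ k) (advance (fromℕ k) λ k≢a →
    above _ (≤∧≢⇒< (Fin.≤fromℕ a) (k≢a ∘ toℕ-injective ∘ sym)))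

  below : ∀ b → toℕ b ≤ toℕ a → P b
  below = <-weakInduction (λ b → toℕ b ≤ toℕ a → P b) (λ _ → first) λ j ih j<a →
    subst P (turn-inject₁ j) (advance (inject₁ j) λ _ →
      ih (subst (_≤ toℕ a) (sym (toℕ-inject₁ j)) (<⇒≤ j<a)))

-- Tours of a graph by darts (vertex , edge slot)

module Darts (d k : ℕ) where

  Dart : Set
  Dart = Fin d × Fin (suc k)

  _≟ᵈ_ : (g h : Dart) → Dec (g ≡ h)
  _≟ᵈ_ = ≡-dec Fin._≟_ Fin._≟_

  D : ℕ
  D = d * suc k

  dart : Fin D → Dart
  dart = remQuot (suc k)

  rotate : Dart → Dart
  rotate (w , s) = w , turn s

  rotate-injective : ∀ {g h} → rotate g ≡ rotate h → g ≡ h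
  rotate-injective eq = cong₂ _,_ (cong proj₁ eq) (turn-injective (cong proj₂ eq))

  -- A state is the index of the starting dart of the current tour together
  -- with the dart about to be crossed; visit i g is the transition taken once
  -- that crossing has led to g.
  State : Set
  State = Fin D × Dart

  -- Initial darts are tried in decreasing order of index. When the tour of dart `zero` has closed
  -- as well, no cycle was found and the answer is `false`. A general `n` allows matching on the
  -- index, since `D` is a product.
  resume : ∀ {n} → (Fin n → Dart) → Fin n → (Fin n × Dart) ⊎ Bool
  resume f zero    = inj₂ false
  resume f (suc i) = inj₁ (inject₁ i , f (inject₁ i))

  resume-view : ∀ {n} (f : Fin n → Dart) i →
                (toℕ i ≡ 0 × resume f i ≡ inj₂ false) ⊎
                (∃[ j ] toℕ i ≡ suc (toℕ j) × resume f i ≡ inj₁ (j , f j))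
  resume-view f zero    = inj₁ (refl , refl)
  resume-view f (suc i) = inj₂ (inject₁ i , cong suc (sym (toℕ-inject₁ i)) , refl)

  visit : Fin D → Dart → State ⊎ Bool
  visit i g with proj₁ g Fin.≟ proj₁ (dart i) | g ≟ᵈ dart i
  ... | no _  | _     = inj₁ (i , rotate g)
  ... | yes _ | yes _ = resume dart i
  -- Back at the first vertex through a different dart: the graph contains a cycle.
  ... | yes _ | no _  = inj₂ true

  -- α crosses a dart: (w , s) goes to (w′ , s) if slot s holds a present edge
  -- w w′, and to itself otherwise.
  module Tour (α : Dart → Dart) (α-involutive : ∀ g → α (α g) ≡ g) where

    π : Dart → Dart
    π = rotate ∘ α

    π^ : ℕ → Dart → Dart
    π^ zero    g = g
    π^ (suc t) g = π^ t (π g)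

    π^-suc : ∀ t g → π^ (suc t) g ≡ π (π^ t g)
    π^-suc zero    g = refl
    π^-suc (suc t) g = π^-suc t (π g)

    π^-+ : ∀ s t g → π^ (s + t) g ≡ π^ t (π^ s g)
    π^-+ zero    t g = refl
    π^-+ (suc s) t g = π^-+ s t (π g)

    π-injective : ∀ {g h} → π g ≡ π h → g ≡ h
    π-injective eq =
      trans (sym (α-involutive _)) (trans (cong α (rotate-injective eq)) (α-involutive _))

    π^-injective : ∀ t {g h} → π^ t g ≡ π^ t h → g ≡ h
    π^-injective zero    eq = eq
    π^-injective (suc t) eq = π-injective (π^-injective t eq)

    -- The position is inspected after a crossing and before the rotation. Hence time 0 already
    -- counts: `Return h 0` means that crossing `h` does not leave its vertex.
    Return : Dart → ℕ → Set
    Return h t = proj₁ (α (π^ t h)) ≡ proj₁ h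

    FirstReturn : Dart → ℕ → Set
    FirstReturn h t = Return h t × (∀ s → s < t → ¬ Return h s)

    Closes : Dart → Set
    Closes h = ∃[ t ] FirstReturn h t × α (π^ t h) ≡ h

    Strays : Dart → Set
    Strays h = ∃[ t ] FirstReturn h t × α (π^ t h) ≢ h

    -- Two of the first `suc D` iterates coincide, and injectivity of `π` cancels their common
    -- prefix, so the orbit comes back to `h`. The final rotation keeps the vertex, so the crossing
    -- before it is already a return.
    return : ∀ h → ∃[ t ] t < D × Return h t
    return h with i , j , i<j , eq ← pigeonhole (n<1+n D) (λ i → uncurry combine (π^ (toℕ i) h)) =
      r , r<D , cong proj₁ (sym h≡π[π^r])
      where
      r = toℕ j ∸ suc (toℕ i)

      i+1+r≡j : suc (toℕ i) + r ≡ toℕ j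
      i+1+r≡j = m+[n∸m]≡n i<j

      r<D : r < D
      r<D = ≤-trans (s≤s (m≤n+m r (toℕ i))) (≤-trans (≤-reflexive i+1+r≡j) (≤-pred (toℕ<n j)))

      h≡π[π^r] : h ≡ π (π^ r h)
      h≡π[π^r] = trans (π^-injective (toℕ i) (begin
        π^ (toℕ i) h                ≡⟨ uncurry (cong₂ _,_) (combine-injective _ _ _ _ eq) ⟩
        π^ (toℕ j) h                ≡⟨ cong (λ t → π^ t h) (sym i+1+r≡j) ⟩
        π^ (suc (toℕ i) + r) h      ≡⟨ cong (λ t → π^ (suc t) h) (+-comm (toℕ i) r) ⟩
        π^ (suc r + toℕ i) h        ≡⟨ π^-+ (suc r) (toℕ i) h ⟩
        π^ (toℕ i) (π^ (suc r) h)   ∎)) (π^-suc r h)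
        where open ≡-Reasoning

    firstReturn : ∀ h → ∃[ t ] t < D × FirstReturn h t
    firstReturn h with n , n<D , ret ← return h
                  with t , t≤n , ret′ , min ← least {Return h} (λ s → _ Fin.≟ _) n ret =
      t , ≤-<-trans t≤n n<D , ret′ , min

    step : State → State ⊎ Bool
    step (i , g) = visit i (α g)

    visit-away : ∀ i g → proj₁ g ≢ proj₁ (dart i) → visit i g ≡ inj₁ (i , rotate g)
    visit-away i g w≢v with proj₁ g Fin.≟ proj₁ (dart i) | g ≟ᵈ dart i
    ... | no _    | _ = refl
    ... | yes w≡v | _ = contradiction w≡v w≢v

    visit-closed : ∀ i g → g ≡ dart i → visit i g ≡ resume dart i
    visit-closed i g g≡h with proj₁ g Fin.≟ proj₁ (dart i) | g ≟ᵈ dart i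
    ... | no w≢v | _      = contradiction (cong proj₁ g≡h) w≢v
    ... | yes _  | yes _  = refl
    ... | yes _  | no g≢h = contradiction g≡h g≢h

    visit-stray : ∀ i g → proj₁ g ≡ proj₁ (dart i) → g ≢ dart i → visit i g ≡ inj₂ true
    visit-stray i g w≡v g≢h with proj₁ g Fin.≟ proj₁ (dart i) | g ≟ᵈ dart i
    ... | no w≢v | _       = contradiction w≡v w≢v
    ... | yes _  | yes g≡h = contradiction g≡h g≢h
    ... | yes _  | no _    = refl

    run-away : ∀ t n i g → (∀ s → s < t → proj₁ (α (π^ s g)) ≢ proj₁ (dart i)) →
               run step (t + n) (i , g) ≡ run step n (i , π^ t g)
    run-away zero    n i g away = refl
    run-away (suc t) n i g away rewrite visit-away i (α g) (away 0 (s≤s z≤n)) =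
      run-away t n i (π g) (λ s s<t → away (suc s) (s≤s s<t))

    run-closed : ∀ t n i → FirstReturn (dart i) t → α (π^ t (dart i)) ≡ dart i →
                 run step (t + suc n) (i , dart i) ≡ [ run step n , id ]′ (resume dart i)
    run-closed t n i (_ , min) closes =
      trans (run-away t (suc n) i (dart i) min) (cong [ run step n , id ]′ (visit-closed i _ closes))

    run-stray : ∀ t n i → FirstReturn (dart i) t → α (π^ t (dart i)) ≢ dart i →
                run step (t + suc n) (i , dart i) ≡ true
    run-stray t n i (ret , min) strays =
      trans (run-away t (suc n) i (dart i) min) (cong [ run step n , id ]′ (visit-stray i _ ret strays))

    Outcome : Fin D → ℕ → Set
    Outcome i n =
      (run step n (i , dart i) ≡ true × ∃ Strays) ⊎
      (run step n (i , dart i) ≡ false × ∀ j → toℕ j ≤ toℕ i → Closes (dart j))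

    -- A tour lasts at most `D` steps, so `suc m * D` steps suffice for the `suc m` tours with
    -- initial index at most `m`.
    Outcomes : ℕ → Set
    Outcomes m = ∀ i n → toℕ i ≡ m → suc m * D ≤ n → Outcome i n

    outcome-step : ∀ m → (∀ m′ → m ≡ suc m′ → Outcomes m′) → Outcomes m
    outcome-step m ih i n i≡m bound with t , t<D , first ← firstReturn (dart i) =
      subst (Outcome i) t+n′≡n (go (α (π^ t (dart i)) ≟ᵈ dart i) (resume-view dart i))
      where
      -- A first return at time `t` uses up `suc t` steps of the clock.
      n′ = n ∸ suc t

      t+n′≡n : t + suc n′ ≡ n
      t+n′≡n = trans (+-suc t n′) (m+[n∸m]≡n (≤-trans t<D (≤-trans (m≤m+n D (m * D)) bound)))

      m*D≤n′ : m * D ≤ n′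
      m*D≤n′ = +-cancelˡ-≤ (suc t) _ _ (begin
        suc t + m * D   ≤⟨ +-monoˡ-≤ (m * D) t<D ⟩
        D + m * D       ≤⟨ bound ⟩
        n               ≡⟨ sym t+n′≡n ⟩
        t + suc n′      ≡⟨ +-suc t n′ ⟩
        suc t + n′      ∎)
        where open ≤-Reasoning

      resumed : ∀ {o} → α (π^ t (dart i)) ≡ dart i → resume dart i ≡ o →
                run step (t + suc n′) (i , dart i) ≡ [ run step n′ , id ]′ o
      resumed closes eq = trans (run-closed t n′ i first closes) (cong [ run step n′ , id ]′ eq)

      go : Dec (α (π^ t (dart i)) ≡ dart i) → _ → Outcome i (t + suc n′)
      go (no strays) _ = inj₁ (run-stray t n′ i first strays , _ , t , first , strays)
      go (yes closes) (inj₁ (i≡0 , eq)) = inj₂ (resumed closes eq , λ j j≤i →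
        subst (Closes ∘ dart) (toℕ-injective (≤-antisym (subst (_≤ toℕ j) (sym i≡0) z≤n) j≤i))
              (t , first , closes))
      go (yes closes) (inj₂ (i′ , i≡1+i′ , eq))
        with m≡1+i′ ← trans (sym i≡m) i≡1+i′
        with ih (toℕ i′) m≡1+i′ i′ n′ refl (subst (λ m → m * D ≤ n′) m≡1+i′ m*D≤n′)
      ... | inj₁ (accepts , strays) = inj₁ (trans (resumed closes eq) accepts , strays)
      ... | inj₂ (rejects , closed) = inj₂ (trans (resumed closes eq) rejects , λ j j≤i →
        [ (λ j<i → closed j (≤-pred (subst (toℕ j <_) i≡1+i′ j<i)))
        , (λ j≡i → subst (Closes ∘ dart) (toℕ-injective (sym j≡i)) (t , first , closes))
        ]′ (m≤n⇒m<n∨m≡n j≤i))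

    outcome : ∀ m → Outcomes m
    outcome zero    = outcome-step zero λ _ ()
    outcome (suc m) = outcome-step (suc m) λ { _ refl → outcome m }

    search : ∀ i → suc (toℕ i) ≡ D →
             (run step (D * D) (i , dart i) ≡ true × ∃ Strays) ⊎
             (run step (D * D) (i , dart i) ≡ false × ∀ h → Closes h)
    search i last with outcome (toℕ i) i (D * D) refl (≤-reflexive (cong (_* D) last))
    ... | inj₁ r = inj₁ r
    ... | inj₂ (rejects , closed) = inj₂ (rejects , λ (w , s) →
      subst Closes (remQuot-combine w s)
        (closed (combine w s) (≤-pred (subst (toℕ (combine w s) <_) (sym last) (toℕ<n (combine w s))))))

    -- κ (w , s) is to be the contribution of slot s at coordinate w to a linear
    -- dependency between the edges.
    module _ (κ : Dart → Parity)
             (κ-α : ∀ g → κ (α g) ≡ κ g)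
             (κ-fixed : ∀ g → α g ≡ g → κ g ≡ 0ℙ)
             (κ-sum : ∀ w → sum (λ s → κ (w , s)) ≡ 0ℙ)
             (closes : ∀ h → Closes h) where

      -- Leaf peeling: the tour of h is made of h, the tours of the other darts
      -- at the head of h, and the reverse of h.
      closes⇒0 : ∀ t h → FirstReturn h t → α (π^ t h) ≡ h → κ h ≡ 0ℙ
      closes⇒0 = <-rec _ go
        where
        go : ∀ t → (∀ {t′} → t′ < t → ∀ h → FirstReturn h t′ → α (π^ t′ h) ≡ h → κ h ≡ 0ℙ) →
             ∀ h → FirstReturn h t → α (π^ t h) ≡ h → κ h ≡ 0ℙ
        -- A tour that closes at time 0 crosses no edge.
        go zero     ih h _ eq = κ-fixed h eq
        -- At the head `u` of `h` every dart except the reverse `(u , s)` of `h` vanishes by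
        -- induction, so the zero sum at `u` forces `(u , s)` to vanish too.
        go (suc t₁) ih h _ eq = begin
          κ h                     ≡⟨ κ-α h ⟨
          κ (u , s)               ≡⟨ sum-single (λ b → κ (u , b)) s others ⟨
          sum (λ b → κ (u , b))   ≡⟨ κ-sum u ⟩
          0ℙ                      ∎
          where
          open ≡-Reasoning
          t = suc t₁
          u = proj₁ (α h)
          s = proj₂ (α h)

          last : π^ t h ≡ α h
          last = trans (sym (α-involutive _)) (cong α eq)

          Departs : Fin (suc k) → Set
          Departs b = ∃[ r ] r ≤ t × π^ r h ≡ (u , b)

          -- The crossing at time `t₁` leads to `u`, from where the tour of `h` departs through
          -- `(u , s)` at time `t`. A tour of `(u , b)` begun at time `r` therefore has its first
          -- return no later than time `t₁`. The case `r ≡ t` would give `b ≡ s`.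
          inside : ∀ b → b ≢ s → ∀ r → r ≤ t → π^ r h ≡ (u , b) →
                   ∀ t′ → FirstReturn (u , b) t′ → r + t′ < t
          inside b b≢s r r≤t eqᵣ t′ (_ , min) with r + t′ <? t
          ... | yes lt = lt
          ... | no ≮t with m≤n⇒m<n∨m≡n r≤t
          ... | inj₂ refl = contradiction (cong proj₂ (trans (sym eqᵣ) last)) b≢s
          ... | inj₁ (s≤s r≤t₁) = contradiction returns (min (t₁ ∸ r) early)
            where
            early : t₁ ∸ r < t′
            early = +-cancelˡ-< r _ _
              (subst (_< r + t′) (sym (m+[n∸m]≡n r≤t₁)) (≮⇒≥ ≮t))

            returns : Return (u , b) (t₁ ∸ r)
            returns = cong proj₁ (begin
              π (π^ (t₁ ∸ r) (u , b))    ≡⟨ cong (π ∘ π^ (t₁ ∸ r)) eqᵣ ⟨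
              π (π^ (t₁ ∸ r) (π^ r h))   ≡⟨ cong π (π^-+ r (t₁ ∸ r) h) ⟨
              π (π^ (r + (t₁ ∸ r)) h)    ≡⟨ cong (λ t → π (π^ t h)) (m+[n∸m]≡n r≤t₁) ⟩
              π (π^ t₁ h)                ≡⟨ π^-suc t₁ h ⟨
              π^ t h                     ≡⟨ last ⟩
              α h                        ∎)

          -- The tour of `h` enters `u` through slot `s`, hence departs through `turn s` at time 1.
          -- A closed tour from slot `b` comes back to slot `b` and rotates to `turn b`, so all
          -- slots at `u` are served in turn.
          departs : ∀ b → Departs b
          departs = turn-induction Departs s (1 , s≤s z≤n , refl) next
            where
            next : ∀ b → b ≢ s → Departs b → Departs (turn b)
            next b b≢s (r , r≤t , eqᵣ) with t′ , first , closed ← closes (u , b) =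
              suc (r + t′) , inside b b≢s r r≤t eqᵣ t′ first , (begin
                π^ (suc (r + t′)) h          ≡⟨ π^-suc (r + t′) h ⟩
                π (π^ (r + t′) h)            ≡⟨ cong π (π^-+ r t′ h) ⟩
                π (π^ t′ (π^ r h))           ≡⟨ cong (π ∘ π^ t′) eqᵣ ⟩
                rotate (α (π^ t′ (u , b)))   ≡⟨ cong rotate closed ⟩
                (u , turn b)                 ∎)

          others : ∀ b → b ≢ s → κ (u , b) ≡ 0ℙ
          others b b≢s with r , r≤t , eqᵣ ← departs b | t′ , first , closed ← closes (u , b) =
            ih (≤-<-trans (m≤n+m t′ r) (inside b b≢s r r≤t eqᵣ t′ first)) _ first closed

      all-close⇒0 : ∀ h → κ h ≡ 0ℙ
      all-close⇒0 h with t , first , closed ← closes h = closes⇒0 t h first closed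

-- Vectors over the two-element field

≢1⇒≡0 : ∀ {a} → a ≢ 1ℙ → a ≡ 0ℙ
≢1⇒≡0 {0ℙ} _   = refl
≢1⇒≡0 {1ℙ} a≢1 = contradiction refl a≢1

0-or-1 : ∀ a → a ≡ 0ℙ ⊎ a ≡ 1ℙ
0-or-1 0ℙ = inj₁ refl
0-or-1 1ℙ = inj₂ refl

module _ {d : ℕ} where

  +ᵛ-comm : ∀ (v w : F₂^ d) → v +ᵛ w ≡ w +ᵛ v
  +ᵛ-comm = Vec.zipWith-comm ℙ.+-comm

  +ᵛ-assoc : ∀ (u v w : F₂^ d) → (u +ᵛ v) +ᵛ w ≡ u +ᵛ (v +ᵛ w)
  +ᵛ-assoc = Vec.zipWith-assoc ℙ.+-assoc

  +ᵛ-identityˡ : ∀ (v : F₂^ d) → 0ᵛ +ᵛ v ≡ v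
  +ᵛ-identityˡ = Vec.zipWith-identityˡ ℙ.+-identityˡ

  +ᵛ-identityʳ : ∀ (v : F₂^ d) → v +ᵛ 0ᵛ ≡ v
  +ᵛ-identityʳ = Vec.zipWith-identityʳ ℙ.+-identityʳ

  +ᵛ-commutativeMonoid : CommutativeMonoid 0ℓ 0ℓ
  +ᵛ-commutativeMonoid = record
    { Carrier = F₂^ d ; _≈_ = _≡_ ; _∙_ = _+ᵛ_ ; ε = 0ᵛ
    ; isCommutativeMonoid = record
      { isMonoid = record
        { isSemigroup = record
          { isMagma = isMagma _+ᵛ_
          ; assoc   = +ᵛ-assoc
          }
        ; identity = +ᵛ-identityˡ , +ᵛ-identityʳ
        }
      ; comm = +ᵛ-comm
      }
    }

  module ∑ = Sum +ᵛ-commutativeMonoid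

  lookup-+ᵛ : ∀ w (u v : F₂^ d) → lookup (u +ᵛ v) w ≡ lookup u w ⊕ lookup v w
  lookup-+ᵛ w = Vec.lookup-zipWith _⊕_ w

  lookup-0ᵛ : ∀ w → lookup (0ᵛ {d}) w ≡ 0ℙ
  lookup-0ᵛ w = Vec.lookup-replicate w 0ℙ

  e-diagonal : ∀ i → lookup (e {d} i) i ≡ 1ℙ
  e-diagonal i = Vec.lookup∘update i 0ᵛ 1ℙ

  e-off : ∀ i j → i ≢ j → lookup (e {d} i) j ≡ 0ℙ
  e-off i j i≢j = trans (Vec.lookup∘update′ (i≢j ∘ sym) 0ᵛ 1ℙ) (lookup-0ᵛ j)

  e-sym : ∀ i j → lookup (e {d} i) j ≡ lookup (e j) i
  e-sym i j with i Fin.≟ j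
  ... | yes refl = refl
  ... | no  i≢j  = trans (e-off i j i≢j) (sym (e-off j i (i≢j ∘ sym)))

v+v≡0 : ∀ {d} (v : F₂^ d) → v +ᵛ v ≡ 0ᵛ
v+v≡0 []      = refl
v+v≡0 (a ∷ v) = cong₂ _∷_ (ℙ.p+p≡0ℙ a) (v+v≡0 v)

0*v≡0 : ∀ {d} (v : F₂^ d) → 0ℙ *ᵛ v ≡ 0ᵛ
0*v≡0 []      = refl
0*v≡0 (a ∷ v) = cong (0ℙ ∷_) (0*v≡0 v)

1*v≡v : ∀ {d} (v : F₂^ d) → 1ℙ *ᵛ v ≡ v
1*v≡v = Vec.map-id

*ᵛ-distrib-+ : ∀ {d} a b (v : F₂^ d) → (a ⊕ b) *ᵛ v ≡ a *ᵛ v +ᵛ b *ᵛ v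
*ᵛ-distrib-+ a b []      = refl
*ᵛ-distrib-+ a b (x ∷ v) = cong₂ _∷_ (ℙ.*-distribʳ-+ x a b) (*ᵛ-distrib-+ a b v)

module _ {d : ℕ} where

  +ᵛ-cancel : ∀ (v w : F₂^ d) → v +ᵛ (v +ᵛ w) ≡ w
  +ᵛ-cancel v w = begin
    v +ᵛ (v +ᵛ w)   ≡⟨ +ᵛ-assoc v v w ⟨
    (v +ᵛ v) +ᵛ w   ≡⟨ cong (_+ᵛ w) (v+v≡0 v) ⟩
    0ᵛ +ᵛ w         ≡⟨ +ᵛ-identityˡ w ⟩
    w               ∎
    where open ≡-Reasoning

  v+w≡0⇒v≡w : ∀ (v w : F₂^ d) → v +ᵛ w ≡ 0ᵛ → v ≡ w
  v+w≡0⇒v≡w v w eq =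
    trans (sym (+ᵛ-identityʳ v)) (trans (cong (v +ᵛ_) (sym eq)) (+ᵛ-cancel v w))

  telescope : ∀ (u v w : F₂^ d) → (u +ᵛ v) +ᵛ (v +ᵛ w) ≡ u +ᵛ w
  telescope u v w = trans (+ᵛ-assoc u v (v +ᵛ w)) (cong (u +ᵛ_) (+ᵛ-cancel v w))

-- Linear combinations

Support : ∀ {m} → (Fin m → Parity) → Pred (Fin m) 0ℓ → Set
Support c P = ∀ p → c p ≡ 1ℙ → P p

support-+ : ∀ {m} {c c′ : Fin m → Parity} {P} → Support c P → Support c′ P →
            Support (λ p → c p ⊕ c′ p) P
support-+ {c = c} c∈P c′∈P p eq with 0-or-1 (c p)
... | inj₁ cp≡0 = c′∈P p (trans (cong (_⊕ _) (sym cp≡0)) eq)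
... | inj₂ cp≡1 = c∈P p cp≡1

support-e : ∀ {m} {P : Pred (Fin m) 0ℓ} p → P p → Support (lookup (e p)) P
support-e p Pp q eq with p Fin.≟ q
... | yes refl = Pp
... | no  p≢q  = contradiction (trans (sym eq) (e-off p q p≢q)) λ ()

module _ {d : ℕ} where

  lc : ∀ {m} → (Fin m → Parity) → (Fin m → F₂^ d) → F₂^ d
  lc c g = ∑.sum λ p → c p *ᵛ g p

  lc-0 : ∀ {m} (g : Fin m → F₂^ d) → lc (λ _ → 0ℙ) g ≡ 0ᵛ
  lc-0 {m} g = trans (∑.sum-cong-≗ λ p → 0*v≡0 (g p)) (∑.sum-replicate-zero m)

  lc-zero : ∀ {m} (c : Fin m → Parity) (g : Fin m → F₂^ d) → (∀ p → c p ≡ 0ℙ) → lc c g ≡ 0ᵛ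
  lc-zero c g c≡0 = trans (∑.sum-cong-≗ λ p → cong (_*ᵛ g p) (c≡0 p)) (lc-0 g)

  lc-+ : ∀ {m} (c c′ : Fin m → Parity) (g : Fin m → F₂^ d) →
         lc (λ p → c p ⊕ c′ p) g ≡ lc c g +ᵛ lc c′ g
  lc-+ c c′ g = trans (∑.sum-cong-≗ λ p → *ᵛ-distrib-+ (c p) (c′ p) (g p))
                      (∑.∑-distrib-+ (λ p → c p *ᵛ g p) (λ p → c′ p *ᵛ g p))

  lc-e : ∀ {m} s (g : Fin m → F₂^ d) → lc (lookup (e s)) g ≡ g s
  lc-e {suc m} zero    g = trans
    (cong₂ _+ᵛ_ (1*v≡v (g zero)) (lc-zero (lookup 0ᵛ) (g ∘ suc) lookup-0ᵛ))
    (+ᵛ-identityʳ _)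
  lc-e {suc m} (suc s) g = trans (cong₂ _+ᵛ_ (0*v≡0 (g zero)) (lc-e s (g ∘ suc))) (+ᵛ-identityˡ _)

  sum-split : ∀ m {n} (f : Fin (m + n) → F₂^ d) →
              ∑.sum f ≡ ∑.sum (f ∘ (_↑ˡ n)) +ᵛ ∑.sum (f ∘ (m ↑ʳ_))
  sum-split zero    f = sym (+ᵛ-identityˡ _)
  sum-split (suc m) f = trans (cong (f zero +ᵛ_) (sum-split m (f ∘ suc))) (sym (+ᵛ-assoc _ _ _))

  lookup-sum : ∀ {m} w (f : Fin m → F₂^ d) →
               lookup (∑.sum f) w ≡ sum (λ p → lookup (f p) w)
  lookup-sum {zero}  w f = lookup-0ᵛ w
  lookup-sum {suc m} w f =
    trans (lookup-+ᵛ w (f zero) _) (cong (lookup (f zero) w ⊕_) (lookup-sum w (f ∘ suc)))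

  module _ {m : ℕ} (g : Fin m → F₂^ d) where

    -- The span of the selected `g p`, with explicit coefficients. Unlike an inductive `Span`, it
    -- can be split by owner and decided by recursion on the family.
    Comb : Pred (Fin m) 0ℓ → Pred (F₂^ d) 0ℓ
    Comb P v = ∃[ c ] Support c P × lc c g ≡ v

    comb-0 : ∀ {P} → 0ᵛ ∈ Comb P
    comb-0 = (λ _ → 0ℙ) , (λ _ ()) , lc-0 g

    comb-+ : ∀ {P v w} → v ∈ Comb P → w ∈ Comb P → v +ᵛ w ∈ Comb P
    comb-+ (c , c∈P , refl) (c′ , c′∈P , refl) = _ , support-+ c∈P c′∈P , lc-+ c c′ g

    comb-* : ∀ {P} a {v} → v ∈ Comb P → a *ᵛ v ∈ Comb P
    comb-* {P} 0ℙ {v} _ = subst (Comb P) (sym (0*v≡0 v)) comb-0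
    comb-* {P} 1ℙ {v} v∈ = subst (Comb P) (sym (1*v≡v v)) v∈

    comb-gen : ∀ {P} p → P p → g p ∈ Comb P
    comb-gen p Pp = lookup (e p) , support-e p Pp , lc-e p g

    span⊆comb : ∀ {P Q} → Q ⊆ Comb P → Span Q ⊆ Comb P
    span⊆comb Q⊆ (gen v∈Q)   = Q⊆ v∈Q
    span⊆comb Q⊆ zero        = comb-0
    span⊆comb Q⊆ (add p q)   = comb-+ (span⊆comb Q⊆ p) (span⊆comb Q⊆ q)
    span⊆comb Q⊆ (mul a p)   = comb-* a (span⊆comb Q⊆ p)

    comb-mono : ∀ {P Q} → P ⊆ Q → Comb P ⊆ Comb Q
    comb-mono P⊆Q (c , c∈P , eq) = c , (λ p → P⊆Q ∘ c∈P p) , eq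

    comb-split : ∀ {P Q v} → Decidable Q → v ∈ Comb P →
                 ∃₂ λ v₁ v₂ → v₁ ∈ Comb (P ∩ Q) × v₂ ∈ Comb (P ∩ ∁ Q) × v₁ +ᵛ v₂ ≡ v
    comb-split {P} {Q} Q? (c , c∈P , refl) =
      _ , _ , (c₁ , support₁ , refl) , (c₂ , support₂ , refl) ,
      trans (sym (lc-+ c₁ c₂ g)) (∑.sum-cong-≗ λ p → cong (_*ᵛ g p) (c₁+c₂ p))
      where
      c₁ c₂ : Fin m → Parity
      c₁ p with Q? p
      ... | yes _ = c p
      ... | no  _ = 0ℙ
      c₂ p with Q? p
      ... | yes _ = 0ℙ
      ... | no  _ = c p

      support₁ : Support c₁ (P ∩ Q)
      support₁ p eq with Q? p
      ... | yes Qp = c∈P p eq , Qp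

      support₂ : Support c₂ (P ∩ ∁ Q)
      support₂ p eq with Q? p
      ... | no ¬Qp = c∈P p eq , ¬Qp

      c₁+c₂ : ∀ p → c₁ p ⊕ c₂ p ≡ c p
      c₁+c₂ p with Q? p
      ... | yes _ = ℙ.+-identityʳ (c p)
      ... | no  _ = refl

    Free : Pred (Fin m) 0ℓ → Set
    Free P = ∀ c → Support c P → lc c g ≡ 0ᵛ → ∀ p → c p ≡ 0ℙ

  module _ {m : ℕ} (g : Fin (suc m) → F₂^ d) where

    lc-0∷ : ∀ c → c zero ≡ 0ℙ → lc c g ≡ lc (c ∘ suc) (g ∘ suc)
    lc-0∷ c eq = trans (cong (_+ᵛ lc (c ∘ suc) (g ∘ suc)) (trans (cong (_*ᵛ g zero) eq) (0*v≡0 (g zero))))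
                       (+ᵛ-identityˡ _)

    lc-1∷ : ∀ c → c zero ≡ 1ℙ → lc c g ≡ g zero +ᵛ lc (c ∘ suc) (g ∘ suc)
    lc-1∷ c eq = cong (_+ᵛ lc (c ∘ suc) (g ∘ suc)) (trans (cong (_*ᵛ g zero) eq) (1*v≡v (g zero)))

    module _ {P : Pred (Fin (suc m)) 0ℓ} where

      -- The leading coefficient is 0 or 1, and in the second case adding `g zero` cancels it.
      -- Membership thus reduces to two memberships for a shorter family, which is how `comb?`
      -- decides it.
      comb-uncons : ∀ {v} → v ∈ Comb g P →
                    v ∈ Comb (g ∘ suc) (P ∘ suc) ⊎
                    (P zero × g zero +ᵛ v ∈ Comb (g ∘ suc) (P ∘ suc))
      comb-uncons (c , c∈P , refl) with 0-or-1 (c zero)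
      ... | inj₁ c₀≡0 = inj₁ (c ∘ suc , c∈P ∘ suc , sym (lc-0∷ c c₀≡0))
      ... | inj₂ c₀≡1 = inj₂ (c∈P zero c₀≡1 , c ∘ suc , c∈P ∘ suc ,
        sym (trans (cong (g zero +ᵛ_) (lc-1∷ c c₀≡1)) (+ᵛ-cancel (g zero) _)))

      comb-skip : ∀ {v} → v ∈ Comb (g ∘ suc) (P ∘ suc) → v ∈ Comb g P
      comb-skip (c , c∈P , refl) =
        0ℙ Vector.∷ c , (λ { zero () ; (suc p) → c∈P p }) , lc-0∷ (0ℙ Vector.∷ c) refl

      comb-take : ∀ {v} → P zero → g zero +ᵛ v ∈ Comb (g ∘ suc) (P ∘ suc) → v ∈ Comb g P
      comb-take {v} P₀ (c , c∈P , eq) =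
        1ℙ Vector.∷ c , (λ { zero _ → P₀ ; (suc p) → c∈P p }) ,
        trans (lc-1∷ (1ℙ Vector.∷ c) refl) (trans (cong (g zero +ᵛ_) eq) (+ᵛ-cancel (g zero) v))

  comb⊆span : ∀ {m} (g : Fin m → F₂^ d) {P Q} → (∀ p → P p → g p ∈ Span Q) → Comb g P ⊆ Span Q
  comb⊆span {zero}  g g∈ (c , _ , refl) = zero
  comb⊆span {suc m} g {P} {Q} g∈ {v} v∈ with comb-uncons g v∈
  ... | inj₁ v∈′        = comb⊆span (g ∘ suc) (g∈ ∘ suc) v∈′
  ... | inj₂ (P₀ , v∈′) = subst (Span Q) (+ᵛ-cancel (g zero) v)
    (add (g∈ zero P₀) (comb⊆span (g ∘ suc) (g∈ ∘ suc) v∈′))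

  comb? : ∀ {m} (g : Fin m → F₂^ d) {P} → Decidable P → Decidable (Comb g P)
  comb? {zero} g P? v with Vec.≡-dec ℙ._≟_ v 0ᵛ
  ... | yes refl = yes ((λ ()) , (λ ()) , refl)
  ... | no  v≢0  = no λ (_ , _ , eq) → v≢0 (sym eq)
  comb? {suc m} g {P} P? v = map′
    [ comb-skip g , (λ (P₀ , v∈) → comb-take g P₀ v∈) ]′
    (comb-uncons g)
    (comb? (g ∘ suc) (P? ∘ suc) v ⊎-dec
      (P? zero ×-dec comb? (g ∘ suc) (P? ∘ suc) (g zero +ᵛ v)))

  -- Keep g p iff it is not spanned by the vectors kept after it.
  basis : ∀ {m} (g : Fin m → F₂^ d) {O : Pred (Fin m) 0ℓ} → Decidable O →
          ∃ λ (K : Pred (Fin m) 0ℓ) →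
            Decidable K × K ⊆ O × Free g K × (∀ p → O p → g p ∈ Comb g K)
  basis {zero} g O? = (λ _ → ⊥) , (λ _ → no λ ()) , (λ ()) , (λ _ _ _ ()) , λ ()
  basis {suc m} g {O} O? with K′ , K′? , K′⊆O , free , spans ← basis (g ∘ suc) (O? ∘ suc)
                      with O? zero ×-dec ¬? (comb? (g ∘ suc) K′? (g zero))
  ... | yes (O₀ , g₀∉) = K , K? , (λ { {zero} _ → O₀ ; {suc p} → K′⊆O }) , free′ , spans′
    where
    K : Pred (Fin (suc m)) 0ℓ
    K zero    = ⊤
    K (suc p) = K′ p

    K? : Decidable K
    K? zero    = yes tt
    K? (suc p) = K′? p

    free′ : Free g K
    free′ c c∈K eq with 0-or-1 (c zero)
    ... | inj₁ c₀≡0 = λ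
      { zero    → c₀≡0
      ; (suc p) → free (c ∘ suc) (c∈K ∘ suc) (trans (sym (lc-0∷ g c c₀≡0)) eq) p }
    -- A dependency that uses `g zero` would express it by the vectors kept after it.
    ... | inj₂ c₀≡1 = contradiction
      (c ∘ suc , c∈K ∘ suc , sym (v+w≡0⇒v≡w _ _ (trans (sym (lc-1∷ g c c₀≡1)) eq))) g₀∉

    spans′ : ∀ p → O p → g p ∈ Comb g K
    spans′ zero    _  = comb-gen g zero tt
    spans′ (suc p) Op = comb-skip g (spans p Op)
  ... | no ¬both = K , K? , (λ { {suc p} → K′⊆O }) , free′ , spans′
    where
    K : Pred (Fin (suc m)) 0ℓ
    K zero    = ⊥
    K (suc p) = K′ p

    K? : Decidable K
    K? zero    = no λ ()
    K? (suc p) = K′? p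

    free′ : Free g K
    free′ c c∈K eq = λ
      { zero    → c₀≡0
      ; (suc p) → free (c ∘ suc) (c∈K ∘ suc) (trans (sym (lc-0∷ g c c₀≡0)) eq) p }
      where
      c₀≡0 : c zero ≡ 0ℙ
      c₀≡0 = ≢1⇒≡0 (c∈K zero)

    spans′ : ∀ p → O p → g p ∈ Comb g K
    spans′ zero    O₀ = comb-skip g
      (decidable-stable (comb? (g ∘ suc) K′? (g zero)) λ g₀∉ → ¬both (O₀ , g₀∉))
    spans′ (suc p) Op = comb-skip g (spans p Op)

-- Transpositions

data Transposed {n} (i j w : Fin n) : Fin n → Set where
  at-source : w ≡ i → Transposed i j w j
  at-target : w ≡ j → Transposed i j w i
  elsewhere : w ≢ i → w ≢ j → Transposed i j w w

transposed : ∀ {n} (i j w : Fin n) → Transposed i j w (transpose i j w)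
transposed i j w with w Fin.≟ i
... | yes w≡i = at-source w≡i
... | no  w≢i with w Fin.≟ j
... | yes w≡j = at-target w≡j
... | no  w≢j = elsewhere w≢i w≢j

transpose-source : ∀ {n} (i j : Fin n) → transpose i j i ≡ j
transpose-source i j with transpose i j i | transposed i j i
... | _ | at-source _      = refl
... | _ | at-target i≡j    = i≡j
... | _ | elsewhere i≢i _  = contradiction refl i≢i

transpose-target : ∀ {n} (i j : Fin n) → transpose i j j ≡ i
transpose-target i j with transpose i j j | transposed i j j
... | _ | at-source j≡i    = j≡i
... | _ | at-target _      = refl
... | _ | elsewhere _ j≢j  = contradiction refl j≢j

transpose-involutive : ∀ {n} (i j w : Fin n) → transpose i j (transpose i j w) ≡ w
transpose-involutive i j w with transpose i j w in eq | transposed i j w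
... | _ | at-source refl = transpose-target i j
... | _ | at-target refl = transpose-source i j
... | _ | elsewhere _ _  = eq

-- Detecting cycles in a graph whose edges are switched on by input bits

-- Slot s queries the bit var s and holds an edge iff val s answers true to it.
module Graph {N d′ k : ℕ}
             (src tgt : Fin (suc k) → Fin (suc d′))
             (var : Fin (suc k) → Fin N) (val : Fin (suc k) → Bool → Bool) where

  open Darts (suc d′) k public

  ends : Fin (suc k) → F₂^ (suc d′)
  ends s = e (src s) -ᵛ e (tgt s)

  Present : BitString N → Fin (suc k) → Set
  Present z s = val s (lookup z (var s)) ≡ true

  Dependent : BitString N → Set
  Dependent z = ∃[ c ] Support c (Present z) × lc c ends ≡ 0ᵛ × ∃[ s ] c s ≡ 1ℙ

  cross : Bool → Dart → Dart
  cross true  (w , s) = transpose (src s) (tgt s) w , s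
  cross false g       = g

  cross-involutive : ∀ b g → cross b (cross b g) ≡ g
  cross-involutive true  (w , s) = cong (_, s) (transpose-involutive (src s) (tgt s) w)
  cross-involutive false g       = refl

  proj₂-cross : ∀ b g → proj₂ (cross b g) ≡ proj₂ g
  proj₂-cross true  g = refl
  proj₂-cross false g = refl

  module Input (z : BitString N) where

    bit : Fin (suc k) → Bool
    bit s = val s (lookup z (var s))

    α : Dart → Dart
    α g = cross (bit (proj₂ g)) g

    proj₂-α : ∀ g → proj₂ (α g) ≡ proj₂ g
    proj₂-α g = proj₂-cross (bit (proj₂ g)) g

    α-involutive : ∀ g → α (α g) ≡ g
    α-involutive g = trans (cong (λ s → cross (bit s) (α g)) (proj₂-α g))
                           (cross-involutive (bit (proj₂ g)) g)

    open Tour α α-involutive public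

    data Crossing (g : Dart) : Dart → Set where
      idle  : Crossing g g
      forth : let s = proj₂ g in Present z s → proj₁ g ≡ src s → Crossing g (tgt s , s)
      back  : let s = proj₂ g in Present z s → proj₁ g ≡ tgt s → Crossing g (src s , s)

    crossing : ∀ g → Crossing g (α g)
    crossing (w , s) with bit s in eq
    ... | false = idle
    ... | true with transpose (src s) (tgt s) w | transposed (src s) (tgt s) w
    ... | _ | at-source w≡ = forth eq w≡
    ... | _ | at-target w≡ = back eq w≡
    ... | _ | elsewhere _ _ = idle

    -- A slot holds at most one edge and its darts move only at the two ends of that edge.
    same-edge : ∀ g h → proj₂ g ≡ proj₂ h → α g ≢ g → α h ≢ h → g ≡ h ⊎ g ≡ α h
    same-edge (w , s) (v , .s) refl αg≢g αh≢h
      with α (w , s) | α (v , s) | crossing (w , s) | crossing (v , s)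
    ... | _ | _ | idle         | _            = contradiction refl αg≢g
    ... | _ | _ | forth _ _    | idle         = contradiction refl αh≢h
    ... | _ | _ | back _ _     | idle         = contradiction refl αh≢h
    ... | _ | _ | forth _ refl | forth _ refl = inj₁ refl
    ... | _ | _ | forth _ refl | back _ refl  = inj₂ refl
    ... | _ | _ | back _ refl  | forth _ refl = inj₂ refl
    ... | _ | _ | back _ refl  | back _ refl  = inj₁ refl

    crossing-ends : ∀ g → α g ≢ g →
                    Present z (proj₂ g) × ends (proj₂ g) ≡ e (proj₁ g) +ᵛ e (proj₁ (α g))
    crossing-ends g αg≢g with α g | crossing g
    ... | _ | idle       = contradiction refl αg≢g
    ... | _ | forth on refl = on , refl
    ... | _ | back on refl  = on , +ᵛ-comm _ _

    -- The edges crossed an odd number of times by a walk from u to v.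
    record Chain (u v : Fin (suc d′)) (Crossed : Fin (suc k) → Set) : Set where
      field
        coeff    : Fin (suc k) → Parity
        present  : Support coeff (Present z)
        crossed  : Support coeff Crossed
        boundary : lc coeff ends ≡ e u +ᵛ e v

    chain-++ : ∀ {u v w C} → Chain u v C → Chain v w C → Chain u w C
    chain-++ {u} {v} {w} p q = record
      { coeff    = λ s → coeff p s ⊕ coeff q s
      ; present  = support-+ (present p) (present q)
      ; crossed  = support-+ (crossed p) (crossed q)
      ; boundary = begin
          lc (λ s → coeff p s ⊕ coeff q s) ends    ≡⟨ lc-+ (coeff p) (coeff q) ends ⟩
          lc (coeff p) ends +ᵛ lc (coeff q) ends   ≡⟨ cong₂ _+ᵛ_ (boundary p) (boundary q) ⟩
          (e u +ᵛ e v) +ᵛ (e v +ᵛ e w)             ≡⟨ telescope (e u) (e v) (e w) ⟩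
          e u +ᵛ e w                               ∎
      }
      where
      open Chain
      open ≡-Reasoning

    chain-map : ∀ {u v C C′} → (∀ {s} → C s → C′ s) → Chain u v C → Chain u v C′
    chain-map C⊆C′ p = record
      { coeff = coeff p ; present = present p
      ; crossed = λ s → C⊆C′ ∘ crossed p s ; boundary = boundary p }
      where open Chain

    step-chain : ∀ g → Chain (proj₁ g) (proj₁ (α g)) (λ s → proj₂ g ≡ s × α g ≢ g)
    step-chain g with α g ≟ᵈ g
    ... | yes αg≡g = record
      { coeff = λ _ → 0ℙ ; present = λ _ () ; crossed = λ _ ()
      ; boundary = trans (lc-0 ends)
          (trans (sym (v+v≡0 (e (proj₁ g)))) (cong (λ u → e (proj₁ g) +ᵛ e (proj₁ u)) (sym αg≡g)))
      }
    ... | no αg≢g with on , eq ← crossing-ends g αg≢g = record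
      { coeff = lookup (e (proj₂ g)) ; present = support-e _ on
      ; crossed = support-e _ (refl , αg≢g) ; boundary = trans (lc-e (proj₂ g) ends) eq
      }

    CrossedBy : ℕ → Dart → Fin (suc k) → Set
    CrossedBy t g s = ∃[ r ] r ≤ t × proj₂ (π^ r g) ≡ s × α (π^ r g) ≢ π^ r g

    tour-chain : ∀ t g → Chain (proj₁ g) (proj₁ (α (π^ t g))) (CrossedBy t g)
    tour-chain zero    g = chain-map (λ c → 0 , z≤n , c) (step-chain g)
    tour-chain (suc t) g = chain-++
      (chain-map (λ c → 0 , z≤n , c) (step-chain g))
      (chain-map (λ (r , r≤t , c) → suc r , s≤s r≤t , c) (tour-chain t (π g)))

    -- Up to its first return a stray tour is a closed walk that crosses its first edge only once.
    -- The edges crossed an odd number of times sum to 0, and the first edge is among them.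
    strays⇒dependent : ∃ Strays → Dependent z
    -- Crossing keeps the slot, so a tour that returns at time 0 arrives at `h` itself and cannot
    -- stray.
    strays⇒dependent (h , zero , (ret , _) , αh≢h) =
      contradiction (cong₂ _,_ ret (proj₂-α h)) αh≢h
    strays⇒dependent (h , suc t , (ret , min) , strays) =
      _ , support-+ (support-e s on) present , closed , s , (begin
        lookup (e s) s ⊕ coeff s   ≡⟨ cong₂ _⊕_ (e-diagonal s) (≢1⇒≡0 (not-again ∘ crossed s)) ⟩
        1ℙ                         ∎)
      where
      open ≡-Reasoning
      s = proj₂ h
      v = proj₁ h
      u = proj₁ (α h)

      αh≢h : α h ≢ h
      αh≢h eq = min 0 (s≤s z≤n) (cong proj₁ eq)

      on : Present z s
      on = proj₁ (crossing-ends h αh≢h)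

      open Chain (tour-chain t (π h))

      -- A second departure through `h` would be preceded by an earlier return to `v`. A crossing in
      -- reverse arrives at `v`: before the end this is an earlier return, and at the end it closes
      -- the tour.
      not-again : ¬ CrossedBy t (π h) s
      not-again (r , r≤t , same , moves) with same-edge (π^ (suc r) h) h same moves αh≢h
      ... | inj₁ eq = min r (s≤s r≤t) (cong proj₁ (trans (sym (π^-suc r h)) eq))
      ... | inj₂ eq with αα ← trans (cong α eq) (α-involutive h) | m≤n⇒m<n∨m≡n r≤t
      ... | inj₁ r<t  = min (suc r) (s≤s r<t) (cong proj₁ αα)
      ... | inj₂ refl = strays αα

      closed : lc (λ s′ → lookup (e s) s′ ⊕ coeff s′) ends ≡ 0ᵛ
      closed = begin
        lc (λ s′ → lookup (e s) s′ ⊕ coeff s′) ends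
          ≡⟨ lc-+ (lookup (e s)) coeff ends ⟩
        lc (lookup (e s)) ends +ᵛ lc coeff ends
          ≡⟨ cong₂ _+ᵛ_ (trans (lc-e s ends) (proj₂ (crossing-ends h αh≢h))) boundary ⟩
        (e v +ᵛ e u) +ᵛ (e u +ᵛ e (proj₁ (α (π^ (suc t) h))))
          ≡⟨ telescope (e v) (e u) _ ⟩
        e v +ᵛ e (proj₁ (α (π^ (suc t) h)))
          ≡⟨ cong (λ w → e v +ᵛ e w) ret ⟩
        e v +ᵛ e v
          ≡⟨ v+v≡0 (e v) ⟩
        0ᵛ ∎

    module _ (loopless : ∀ s → Present z s → src s ≢ tgt s)
             (closes : ∀ h → Closes h)
             (c : Fin (suc k) → Parity) (c∈ : Support c (Present z)) (c≡0 : lc c ends ≡ 0ᵛ) where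

      κ : Dart → Parity
      κ (w , s) = c s ⊗ lookup (ends s) w

      -- Minus is plus here, so an edge vector does not depend on the orientation. This makes `κ`
      -- invariant under crossing.
      ends-symmetric : ∀ s → lookup (ends s) (tgt s) ≡ lookup (ends s) (src s)
      ends-symmetric s = begin
        lookup (ends s) j                 ≡⟨ lookup-+ᵛ j (e i) (e j) ⟩
        lookup (e i) j ⊕ lookup (e j) j   ≡⟨ cong₂ _⊕_ (e-sym i j) (trans (e-diagonal j) (sym (e-diagonal i))) ⟩
        lookup (e j) i ⊕ lookup (e i) i   ≡⟨ ℙ.+-comm (lookup (e j) i) (lookup (e i) i) ⟩
        lookup (e i) i ⊕ lookup (e j) i   ≡⟨ lookup-+ᵛ i (e i) (e j) ⟨
        lookup (ends s) i                 ∎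
        where
        open ≡-Reasoning
        i = src s
        j = tgt s

      κ-α : ∀ g → κ (α g) ≡ κ g
      κ-α g with α g | crossing g
      ... | _ | idle         = refl
      ... | _ | forth _ refl = cong (c (proj₂ g) ⊗_) (ends-symmetric (proj₂ g))
      ... | _ | back _ refl  = cong (c (proj₂ g) ⊗_) (sym (ends-symmetric (proj₂ g)))

      -- If `c s` is 1, the slot holds an edge that is not a loop. A fixed dart then lies off both
      -- ends, where the edge vector has coordinate 0.
      κ-fixed : ∀ g → α g ≡ g → κ g ≡ 0ℙ
      κ-fixed (w , s) fixed with 0-or-1 (c s)
      ... | inj₁ cs≡0 = cong (_⊗ lookup (ends s) w) cs≡0
      ... | inj₂ cs≡1
        with on ← c∈ s cs≡1
        with transpose (src s) (tgt s) w | transposed (src s) (tgt s) w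
           | cong proj₁ (trans (cong (λ b → cross b (w , s)) (sym on)) fixed)
      ... | _ | at-source w≡i     | j≡w = contradiction (trans (sym w≡i) (sym j≡w)) (loopless s on)
      ... | _ | at-target w≡j     | i≡w = contradiction (trans i≡w w≡j) (loopless s on)
      ... | _ | elsewhere w≢i w≢j | _   = begin
        c s ⊗ lookup (ends s) w    ≡⟨ cong (c s ⊗_) (lookup-+ᵛ w (e (src s)) (e (tgt s))) ⟩
        c s ⊗ (lookup (e (src s)) w ⊕ lookup (e (tgt s)) w)
          ≡⟨ cong (c s ⊗_) (cong₂ _⊕_ (e-off _ w (w≢i ∘ sym)) (e-off _ w (w≢j ∘ sym))) ⟩
        c s ⊗ 0ℙ   ≡⟨ ℙ.*-zeroʳ (c s) ⟩
        0ℙ         ∎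
        where open ≡-Reasoning

      κ-sum : ∀ w → sum (λ s → κ (w , s)) ≡ 0ℙ
      κ-sum w = begin
        sum (λ s → c s ⊗ lookup (ends s) w)    ≡⟨ sum-cong-≗ (λ s → Vec.lookup-map w (c s ⊗_) (ends s)) ⟨
        sum (λ s → lookup (c s *ᵛ ends s) w)   ≡⟨ lookup-sum w (λ s → c s *ᵛ ends s) ⟨
        lookup (lc c ends) w                   ≡⟨ cong (λ v → lookup v w) c≡0 ⟩
        lookup (0ᵛ {suc d′}) w                 ≡⟨ lookup-0ᵛ w ⟩
        0ℙ                                     ∎
        where open ≡-Reasoning

      closes⇒free : ∀ s → c s ≡ 0ℙ
      closes⇒free s with 0-or-1 (c s)
      ... | inj₁ cs≡0 = cs≡0
      -- An edge that is not a loop has coordinate 1 at its source, so `κ` there equals `c s`.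
      ... | inj₂ cs≡1 = contradiction (trans (sym (all-close⇒0 κ κ-α κ-fixed κ-sum closes (src s , s))) (begin
        c s ⊗ lookup (ends s) (src s)      ≡⟨ cong₂ _⊗_ cs≡1 (lookup-+ᵛ (src s) (e (src s)) (e (tgt s))) ⟩
        lookup (e (src s)) (src s) ⊕ lookup (e (tgt s)) (src s)
          ≡⟨ cong₂ _⊕_ (e-diagonal (src s)) (e-off (tgt s) (src s) (loopless s (c∈ s cs≡1) ∘ sym)) ⟩
        1ℙ ∎)) λ ()
        where open ≡-Reasoning

  δ : State → Bool → State ⊎ Bool
  δ (i , g) b = visit i (cross (val (proj₂ g) b) g)

  encode : State → Fin (D * D)
  encode (i , w , s) = combine i (combine w s)

  decode : Fin (D * D) → State
  decode j = proj₁ (remQuot {D} D j) , dart (proj₂ (remQuot {D} D j))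

  decode-encode : decode ∘ encode ≗ id
  decode-encode (i , w , s) = trans
    (cong (λ (i , g) → i , dart g) (remQuot-combine i (combine w s)))
    (cong (i ,_) (remQuot-combine w s))

  -- `D` unfolds to `suc (k + d′ * suc k)`, so this is the largest index, from which the search
  -- counts down.
  last : Fin D
  last = fromℕ (k + d′ * suc k)

  module Machine = Unroll (var ∘ proj₂ ∘ proj₂ ∘ decode) (λ j → map₁ encode ∘ δ (decode j))

  -- The first argument is the predecessor of `D * D`, the number of steps granted to `search`. As
  -- there are also `D * D` states, the program has `D * D * (D * D)` inner vertices.
  cycleProgram : BranchingProgram N
  cycleProgram = Machine.program (k + d′ * suc k + (k + d′ * suc k) * D) (encode (last , dart last))

  module _ (z : BitString N) where

    open Input z

    accepts⇔run : BranchingProgram.Accepts cycleProgram z ⇔ (run step (D * D) (last , dart last) ≡ true)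
    accepts⇔run = subst (λ b → BranchingProgram.Accepts cycleProgram z ⇔ (b ≡ true))
      (run-map encode decode decode-encode step (D * D) (last , dart last))
      (Machine.accepts⇔run (k + d′ * suc k + (k + d′ * suc k) * D) (encode (last , dart last)) z)

    module _ (loopless : ∀ s → Present z s → src s ≢ tgt s) where

      -- A disjunction rather than an equivalence, because it lets acceptance be derived
      -- constructively from the negated condition in `represents`.
      decide : (BranchingProgram.Accepts cycleProgram z × Dependent z) ⊎
               (¬ BranchingProgram.Accepts cycleProgram z × ¬ Dependent z)
      decide with search last (cong suc (toℕ-fromℕ (k + d′ * suc k)))
      ... | inj₁ (accepts , strays) =
        inj₁ (Equivalence.from accepts⇔run accepts , strays⇒dependent strays)
      ... | inj₂ (rejects , closes) = inj₂
        ( (λ acc → contradiction (trans (sym rejects) (Equivalence.to accepts⇔run acc)) λ ())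
        , (λ (c , c∈ , c≡0 , s , cs≡1) →
            contradiction (trans (sym (closes⇒free loopless closes c c∈ c≡0 s)) cs≡1) λ ()))

-- Edge bases for one side of a decomposition

anyBool? : ∀ {P : Pred Bool 0ℓ} → Decidable P → Dec (∃ P)
anyBool? P? = map′ [ (true ,_) , (false ,_) ]′ (λ { (true , p) → inj₁ p ; (false , p) → inj₂ p })
                   (P? true ⊎-dec P? false)

does⇒ : ∀ {A : Set} (A? : Dec A) → does A? ≡ true → A
does⇒ (yes a) _ = a

-- Edge slots are ordered pairs; loops are excluded by Owned, and of two opposite
-- pairs the greedy choice keeps at most one.
source target : ∀ d → Fin (d * d) → Fin d
source d = proj₁ ∘ remQuot {d} d
target d = proj₂ ∘ remQuot {d} d

difference : ∀ d → Fin (d * d) → F₂^ d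
difference d p = e (source d p) -ᵛ e (target d p)

-- What one side contributes to the graph: for each input a forest whose edge space is `Φ x`, each
-- slot being governed by a single input bit.
record EdgeQueries {n d} (Φ : BitString n → Pred (F₂^ d) 0ℓ) : Set₁ where
  field
    var : Fin (d * d) → Fin n
    val : Fin (d * d) → Bool → Bool

  Active : BitString n → Fin (d * d) → Set
  Active x p = val p (lookup x (var p)) ≡ true

  field
    loopless : ∀ x p → Active x p → source d p ≢ target d p
    spans    : ∀ x → Φ x ⊆ Comb (difference d) (Active x)
    sound    : ∀ x → Comb (difference d) (Active x) ⊆ Φ x
    free     : ∀ x → Free (difference d) (Active x)

module EdgeBasis {n d : ℕ} (i₀ : Fin n) (U : Family n d)
                 (differences : SpannedByDifferences U) (independent : Independent U) where

  S : Fin n × Bool → Pred (F₂^ d) 0ℓ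
  S (i , a) = proj₁ (differences i a)

  S? : ∀ o → Decidable (S o)
  S? (i , a) = proj₁ (proj₂ (differences i a))

  S⊆Differences : ∀ o → S o ⊆ Differences
  S⊆Differences (i , a) = proj₁ (proj₂ (proj₂ (differences i a)))

  ⟦U⟧ : Fin n × Bool → Pred (F₂^ d) 0ℓ
  ⟦U⟧ (i , a) = ⟦ U i a ⟧

  ⟦U⟧⊆Span : ∀ o → ⟦U⟧ o ⊆ Span (S o)
  ⟦U⟧⊆Span (i , a) = proj₁ (proj₂ (proj₂ (proj₂ (differences i a))))

  S⊆⟦U⟧ : ∀ o → S o ⊆ ⟦U⟧ o
  S⊆⟦U⟧ (i , a) = proj₂ (proj₂ (proj₂ (proj₂ (differences i a)))) ∘ gen

  Owned : Pred (Fin (d * d)) 0ℓ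
  Owned p = source d p ≢ target d p × ∃₂ λ i a → difference d p ∈ S (i , a)

  Owned? : Decidable Owned
  Owned? p = ¬? (source d p Fin.≟ target d p) ×-dec
             any? (λ i → anyBool? (λ a → S? (i , a) (difference d p)))

  -- The value at an unowned slot is junk; i₀ only serves to supply it.
  owner : Fin (d * d) → Fin n × Bool
  owner p with Owned? p
  ... | yes (_ , i , a , _) = i , a
  ... | no  _               = i₀ , true

  owner-owns : ∀ p → Owned p → difference d p ∈ S (owner p)
  owner-owns p owned with Owned? p
  ... | yes (_ , i , a , p∈) = p∈
  ... | no  ¬owned           = contradiction owned ¬owned

  disjoint : ∀ S₁ S₂ → (∀ {o} → o ∈ S₁ → ¬ o ∈ S₂) →
             ∀ {v} → v ∈ spanOver U S₁ → v ∈ spanOver U S₂ → v ≡ 0ᵛ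
  disjoint S₁ S₂ dis v∈₁ v∈₂ =
    sym (proj₁ (independent S₁ S₂ (λ (o∈₁ , o∈₂) → dis o∈₁ o∈₂)) (v∈₁ , v∈₂))

  _≟ᵒ_ : (o o′ : Fin n × Bool) → Dec (o ≡ o′)
  _≟ᵒ_ = ≡-dec Fin._≟_ Bool._≟_

  abstract
    chosen : ∃ λ (K : Pred (Fin (d * d)) 0ℓ) →
             Decidable K × K ⊆ Owned × Free (difference d) K ×
             (∀ p → Owned p → difference d p ∈ Comb (difference d) K)
    chosen = basis (difference d) Owned?

  K : Pred (Fin (d * d)) 0ℓ
  K = proj₁ chosen

  K? : Decidable K
  K? = proj₁ (proj₂ chosen)

  K⊆Owned : K ⊆ Owned
  K⊆Owned = proj₁ (proj₂ (proj₂ chosen))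

  K-free : Free (difference d) K
  K-free = proj₁ (proj₂ (proj₂ (proj₂ chosen)))

  K-spans : ∀ p → Owned p → difference d p ∈ Comb (difference d) K
  K-spans = proj₂ (proj₂ (proj₂ (proj₂ chosen)))

  owned-by-span : ∀ {P : Pred (Fin n × Bool) 0ℓ} {Q} → Q ⊆ K → (∀ {p} → Q p → P (owner p)) →
                  Comb (difference d) Q ⊆ spanOver U P
  owned-by-span Q⊆K owned = comb⊆span (difference d) λ p Qp →
    gen (_ , _ , owned Qp , S⊆⟦U⟧ (owner p) (owner-owns p (K⊆Owned (Q⊆K Qp))))

  -- The greedy choice ignores owners, and independence restores them. Expand an edge of `S o` in
  -- kept edges: the part `v₂` not owned by `o` is also the edge plus the part owned by `o`, so it
  -- lies in two spans that meet only in 0.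
  spanned-by-own : ∀ o → ⟦U⟧ o ⊆ Comb (difference d) (K ∩ λ p → owner p ≡ o)
  spanned-by-own o v∈U = span⊆comb (difference d) generator (⟦U⟧⊆Span o v∈U)
    where
    edge-case : ∀ p → Owned p → difference d p ∈ S o →
                difference d p ∈ Comb (difference d) (K ∩ λ p → owner p ≡ o)
    edge-case p owned p∈ with owner p ≟ᵒ o
    -- An edge of `S o` assigned to another owner lies in two different subspaces of the family, so
    -- independence makes it 0.
    ... | no owner≢o = subst (_∈ Comb (difference d) (K ∩ λ p → owner p ≡ o))
      (sym (disjoint ｛ o ｝ ｛ owner p ｝ (λ { refl eq → owner≢o eq })
        (gen (_ , _ , refl , S⊆⟦U⟧ o p∈))
        (gen (_ , _ , refl , S⊆⟦U⟧ (owner p) (owner-owns p owned)))))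
      (comb-0 (difference d))
    ... | yes owner≡o
      with v₁ , v₂ , v₁∈ , v₂∈ , eq ← comb-split (difference d) (λ q → owner q ≟ᵒ o) (K-spans p owned) =
      subst (_∈ Comb (difference d) (K ∩ λ p → owner p ≡ o)) (v+w≡0⇒v≡w v₁ (difference d p) v₁+p≡0) v₁∈
      where
      v₁+p≡v₂ : v₁ +ᵛ difference d p ≡ v₂
      v₁+p≡v₂ = trans (cong (v₁ +ᵛ_) (sym eq)) (+ᵛ-cancel v₁ v₂)

      v₁+p≡0 : v₁ +ᵛ difference d p ≡ 0ᵛ
      v₁+p≡0 = disjoint (_≡ o) (_≢ o) (λ eq ≢o → ≢o eq)
        (add (owned-by-span proj₁ proj₂ v₁∈) (gen (_ , _ , refl , S⊆⟦U⟧ o p∈)))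
        (subst (_∈ spanOver U (_≢ o)) (sym v₁+p≡v₂) (owned-by-span proj₁ proj₂ v₂∈))

    generator : S o ⊆ Comb (difference d) (K ∩ λ p → owner p ≡ o)
    generator {v} v∈S with i , j , i≢j , v≡ ← S⊆Differences o v∈S =
      subst (_∈ Comb (difference d) (K ∩ λ p → owner p ≡ o)) p≡v
        (edge-case p (subst (uncurry _≢_) (sym (remQuot-combine i j)) i≢j , _ , _ , p∈S) p∈S)
      where
      p = combine i j

      p≡v : difference d p ≡ v
      p≡v = trans (cong (λ (i , j) → e i -ᵛ e j) (remQuot-combine i j)) (sym v≡)

      p∈S : difference d p ∈ S o
      p∈S = subst (_∈ S o) (sym p≡v) v∈S

  edgeQueries : EdgeQueries (φ U)
  edgeQueries = record
    { var      = proj₁ ∘ owner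
    ; val      = val
    ; loopless = λ x p on → proj₁ (K⊆Owned (proj₁ (active x p on)))
    ; spans    = λ x → span⊆comb (difference d) λ (i , v∈U) →
        comb-mono (difference d) (λ {p} (Kp , eq) → dec-true (active? p _)
                    (Kp , trans (cong (lookup x ∘ proj₁) eq) (sym (cong proj₂ eq))))
                  (spanned-by-own (i , lookup x i) v∈U)
    ; sound    = λ x → comb⊆span (difference d) λ p on → gen (_ , in-U x p (active x p on))
    ; free     = λ x c c∈ → K-free c (λ p → proj₁ ∘ active x p ∘ c∈ p)
    }
    where
    active? : ∀ p b → Dec (K p × b ≡ proj₂ (owner p))
    active? p b = K? p ×-dec (b Bool.≟ proj₂ (owner p))

    -- A slot outside `K` stays empty for both bit values, so junk owners never matter.
    val : Fin (d * d) → Bool → Bool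
    val p b = does (active? p b)

    active : ∀ x p → val p (lookup x (proj₁ (owner p))) ≡ true →
             K p × lookup x (proj₁ (owner p)) ≡ proj₂ (owner p)
    active x p = does⇒ (active? p _)

    in-U : ∀ x p → K p × lookup x (proj₁ (owner p)) ≡ proj₂ (owner p) →
           difference d p ∈ ⟦ U (proj₁ (owner p)) (lookup x (proj₁ (owner p))) ⟧
    in-U x p (Kp , eq) = subst (λ a → difference d p ∈ ⟦ U (proj₁ (owner p)) a ⟧) (sym eq)
      (S⊆⟦U⟧ (owner p) (owner-owns p (K⊆Owned Kp)))

-- The union of the two forests

data Split {m n} : Fin (m + n) → Set where
  left  : ∀ i → Split (i ↑ˡ n)
  right : ∀ j → Split (m ↑ʳ j)

split : ∀ m {n} (i : Fin (m + n)) → Split {m} {n} i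
split m i with splitAt m i in eq
... | inj₁ j = subst Split (splitAt⁻¹-↑ˡ eq) (left j)
... | inj₂ j = subst Split (splitAt⁻¹-↑ʳ {m} eq) (right j)

module Meet {n d′ : ℕ} {Φ Ψ : BitString n → Pred (F₂^ suc d′) 0ℓ}
            (𝒰 : EdgeQueries Φ) (𝒱 : EdgeQueries Ψ) where

  d = suc d′
  module 𝒰 = EdgeQueries 𝒰
  module 𝒱 = EdgeQueries 𝒱

  -- The sides occupy separate slots, so an edge present on both is doubled and counts as a cycle.
  open Graph {n + n} {d′} (source d ++ source d) (target d ++ target d)
             ((λ p → 𝒰.var p ↑ˡ n) ++ (λ p → n ↑ʳ 𝒱.var p)) (𝒰.val ++ 𝒱.val)

  meetProgram : BranchingProgram (n + n)
  meetProgram = cycleProgram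

  module _ (x y : BitString n) where

    present-left : ∀ p → Input.bit (x ++ᵛ y) (p ↑ˡ d * d) ≡ 𝒰.val p (lookup x (𝒰.var p))
    present-left p rewrite splitAt-↑ˡ (d * d) p (d * d) =
      cong (𝒰.val p) (Vec.lookup-++ˡ x y (𝒰.var p))

    present-right : ∀ p → Input.bit (x ++ᵛ y) (d * d ↑ʳ p) ≡ 𝒱.val p (lookup y (𝒱.var p))
    present-right p rewrite splitAt-↑ʳ (d * d) (d * d) p =
      cong (𝒱.val p) (Vec.lookup-++ʳ x y (𝒱.var p))

  ends-left : ∀ p → ends (p ↑ˡ d * d) ≡ difference d p
  ends-left p rewrite splitAt-↑ˡ (d * d) p (d * d) = refl

  ends-right : ∀ p → ends (d * d ↑ʳ p) ≡ difference d p
  ends-right p rewrite splitAt-↑ʳ (d * d) (d * d) p = refl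

  decoupled : ∀ c → lc c ends ≡
              lc (c ∘ (_↑ˡ d * d)) (difference d) +ᵛ lc (c ∘ (d * d ↑ʳ_)) (difference d)
  decoupled c = trans (sum-split (d * d) (λ s → c s *ᵛ ends s)) (cong₂ _+ᵛ_
    (∑.sum-cong-≗ λ p → cong (c (p ↑ˡ d * d) *ᵛ_) (ends-left p))
    (∑.sum-cong-≗ λ p → cong (c (d * d ↑ʳ p) *ᵛ_) (ends-right p)))

  loopless : ∀ x y s → Present (x ++ᵛ y) s → (source d ++ source d) s ≢ (target d ++ target d) s
  loopless x y s on with split (d * d) {d * d} s
  ... | left p = subst₂ _≢_
    (sym (Vector.lookup-++ˡ (source d) (source d) p))
    (sym (Vector.lookup-++ˡ (target d) (target d) p))
    (𝒰.loopless x p (trans (sym (present-left x y p)) on))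
  ... | right p = subst₂ _≢_
    (sym (Vector.lookup-++ʳ (source d) (source d) p))
    (sym (Vector.lookup-++ʳ (target d) (target d) p))
    (𝒱.loopless y p (trans (sym (present-right x y p)) on))

  module _ (x y : BitString n) where

    -- The two halves of a dependency express the same vector, one on each side. Were it 0, freeness
    -- on each side would make all coefficients vanish.
    dependent⇒meet : Dependent (x ++ᵛ y) → ¬ (Φ x ∩ Ψ y ≐ ｛ 0ᵛ ｝)
    dependent⇒meet (c , c∈ , c≡0 , s , cs≡1) (meet⊆0 , _) = contradiction (trans (sym cs≡1) (vanishes s)) λ ()
      where
      c₁ c₂ : Fin (d * d) → Parity
      c₁ = c ∘ (_↑ˡ d * d)
      c₂ = c ∘ (d * d ↑ʳ_)

      c₁∈ : Support c₁ (𝒰.Active x)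
      c₁∈ p eq = trans (sym (present-left x y p)) (c∈ (p ↑ˡ d * d) eq)

      c₂∈ : Support c₂ (𝒱.Active y)
      c₂∈ p eq = trans (sym (present-right x y p)) (c∈ (d * d ↑ʳ p) eq)

      v₁≡v₂ : lc c₁ (difference d) ≡ lc c₂ (difference d)
      v₁≡v₂ = v+w≡0⇒v≡w _ _ (trans (sym (decoupled c)) c≡0)

      v₁≡0 : lc c₁ (difference d) ≡ 0ᵛ
      v₁≡0 = sym (meet⊆0 (𝒰.sound x (c₁ , c₁∈ , refl) , 𝒱.sound y (c₂ , c₂∈ , sym v₁≡v₂)))

      vanishes : ∀ s → c s ≡ 0ℙ
      vanishes s with split (d * d) {d * d} s
      ... | left p  = 𝒰.free x c₁ c₁∈ v₁≡0 p
      ... | right p = 𝒱.free y c₂ c₂∈ (trans (sym v₁≡v₂) v₁≡0) p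

    -- The expansions of a common vector `v` on the two sides add up to `v +ᵛ v`, which is 0. With
    -- no dependency available their coefficients all vanish, hence so does `v`.
    ¬dependent⇒disjoint : ¬ Dependent (x ++ᵛ y) → Φ x ∩ Ψ y ≐ ｛ 0ᵛ ｝
    ¬dependent⇒disjoint independent = meet⊆0 , λ { refl →
      𝒰.sound x (comb-0 (difference d)) , 𝒱.sound y (comb-0 (difference d)) }
      where
      meet⊆0 : Φ x ∩ Ψ y ⊆ ｛ 0ᵛ ｝
      meet⊆0 {v} (v∈Φ , v∈Ψ)
        with c₁ , c₁∈ , eq₁ ← 𝒰.spans x v∈Φ
           | c₂ , c₂∈ , eq₂ ← 𝒱.spans y v∈Ψ =
        trans (sym (lc-zero c₁ (difference d) λ p →
                trans (sym (Vector.lookup-++ˡ c₁ c₂ p)) (≢1⇒≡0 (none (p ↑ˡ d * d)))))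
              eq₁
        where
        c : Fin (d * d + d * d) → Parity
        c = c₁ ++ c₂

        c∈ : Support c (Present (x ++ᵛ y))
        c∈ s eq with split (d * d) {d * d} s
        ... | left p  = trans (present-left x y p)
                              (c₁∈ p (trans (sym (Vector.lookup-++ˡ c₁ c₂ p)) eq))
        ... | right p = trans (present-right x y p)
                              (c₂∈ p (trans (sym (Vector.lookup-++ʳ c₁ c₂ p)) eq))

        c≡0 : lc c ends ≡ 0ᵛ
        c≡0 = begin
          lc c ends                                               ≡⟨ decoupled c ⟩
          lc (c ∘ (_↑ˡ d * d)) (difference d) +ᵛ lc (c ∘ (d * d ↑ʳ_)) (difference d)
            ≡⟨ cong₂ _+ᵛ_ (∑.sum-cong-≗ λ p → cong (_*ᵛ difference d p) (Vector.lookup-++ˡ c₁ c₂ p))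
                          (∑.sum-cong-≗ λ p → cong (_*ᵛ difference d p) (Vector.lookup-++ʳ c₁ c₂ p)) ⟩
          lc c₁ (difference d) +ᵛ lc c₂ (difference d)   ≡⟨ cong₂ _+ᵛ_ eq₁ eq₂ ⟩
          v +ᵛ v                                         ≡⟨ v+v≡0 v ⟩
          0ᵛ                                             ∎
          where open ≡-Reasoning

        none : ∀ s → c s ≢ 1ℙ
        none s cs≡1 = independent (c , c∈ , c≡0 , s , cs≡1)

    accepts⇔meet : BranchingProgram.Accepts meetProgram (x ++ᵛ y) ⇔ (¬ (Φ x ∩ Ψ y ≐ ｛ 0ᵛ ｝))
    accepts⇔meet with decide (x ++ᵛ y) (loopless x y)
    ... | inj₁ (accepts , dependent)  = mk⇔ (λ _ → dependent⇒meet dependent) (λ _ → accepts)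
    ... | inj₂ (rejects , independent) = mk⇔
      (λ accepts → contradiction accepts rejects)
      (λ meet → contradiction (¬dependent⇒disjoint independent) meet)

-- The size bound and the theorem

-- `D` counts darts: `d` vertices times two blocks of `d * d` slots. One factor `d` absorbs the
-- doubling, which gives `d ^ 4` for `D` and `d ^ 16` for the inner vertices; one more absorbs the
-- two sinks.
size-bound : ∀ d → 2 ≤ d → let D = d * (d * d + d * d) in 2 + D * D * (D * D) ≤ d ^ 17
size-bound d@(suc _) 2≤d = begin
  2 + D * D * (D * D)      ≤⟨ +-mono-≤ (≤-trans 2≤d d≤d^16) (*-mono-≤ D²≤d^8 D²≤d^8) ⟩
  d ^ 16 + d ^ 8 * d ^ 8   ≡⟨ cong (d ^ 16 +_) (^-distribˡ-+-* d 8 8) ⟨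
  d ^ 16 + d ^ 16          ≡⟨ cong (d ^ 16 +_) (+-identityʳ (d ^ 16)) ⟨
  2 * d ^ 16               ≤⟨ *-monoˡ-≤ (d ^ 16) 2≤d ⟩
  d ^ 17                   ∎
  where
  open ≤-Reasoning
  D = d * (d * d + d * d)

  d≤d^16 : d ≤ d ^ 16
  d≤d^16 = subst (_≤ d ^ 16) (*-identityʳ d) (^-monoʳ-≤ d {1} {16} (s≤s z≤n))

  D≤d^4 : D ≤ d ^ 4
  D≤d^4 = begin
    d * (d * d + d * d)   ≡⟨ cong (λ a → d * (d * d + a)) (+-identityʳ (d * d)) ⟨
    d * (2 * (d * d))     ≤⟨ *-monoʳ-≤ d (*-monoˡ-≤ (d * d) 2≤d) ⟩
    d * (d * (d * d))     ≡⟨ cong (λ a → d * (d * (d * a))) (*-identityʳ d) ⟨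
    d ^ 4                 ∎

  D²≤d^8 : D * D ≤ d ^ 8
  D²≤d^8 = begin
    D * D           ≤⟨ *-mono-≤ D≤d^4 D≤d^4 ⟩
    d ^ 4 * d ^ 4   ≡⟨ ^-distribˡ-+-* d 4 4 ⟨
    d ^ 8           ∎

decomposition⇒program : ∀ {n} {f : BoolFun₂ n} {d} → Fin n → 2 ≤ d → BitwiseDecomposition f d →
  Σ[ P ∈ BranchingProgram (n + n) ] (BranchingProgram.size P ≤ d ^ 17 × Computes P f)
decomposition⇒program {d = suc d′} i₀ 2≤d B =
  meetProgram , size-bound (suc d′) 2≤d , λ x y →
    ⇔-sym (represents x y) ⇔-∘ accepts⇔meet x y
  where
  open BitwiseDecomposition B
  open Meet (EdgeBasis.edgeQueries i₀ U U-differences U-independent)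
            (EdgeBasis.edgeQueries i₀ V V-differences V-independent)

theorem1p2 : Σ[ c ∈ ℕ ] (0 < c ×
    ((f : ∀ n → BoolFun₂ n) (d : ℕ → ℕ) →
    (∀ n → bitpdim (f n) ≤ d n) →
    ∀ n → .{{_ : NonZero n}} → 2 ≤ d n →
    Σ[ P ∈ BranchingProgram (n + n) ]
    (BranchingProgram.size P ≤ d n ^ c × Computes P (f n))))
-- A positive `n` supplies the index `zero` as the default variable for slots without an owner.
theorem1p2 = 17 , s≤s z≤n , λ { f d bound (suc n) 2≤d → decomposition⇒program zero 2≤d (bound (suc n)) }
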